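{- Enumerating the edges of a spanning tree of an unweighted, undirected, connected graph $G$ with $n$ vertices and average degree $\overline{\Delta}$ can be done without preprocessing, with delay in $O(\overline{\Delta})$, with $\Theta(n)$ lazy-initialized memory and with space complexity in $\Theta(n)$.
   Context: Graphs $G=(V,E)$ have vertex set $V=\{1,\dots,n\}$ and $m=|E|$ edges. The average degree is $\overline{\Delta}=\frac1n\sum_{v\in V}\deg(v)$. A spanning tree of $G$ is a connected acyclic subgraph $T=(V,E')$ with $E'\subseteq E$ (so $|E'|=n-1$). Model: word RAM with word size in $\Omega(\log n)$, so that a reference to a vertex or edge fits in a constant number of cells that can be read and written in constant time. The graph is given by adjacency lists; the length of each adjacency list can be queried in constant time. Lazy-initialized memory is a block of memory that can be reserved (as if initialized with default values) within constant time, regardless of its size. Space complexity counts the working memory used in addition to the input. Enumeration: given the whole input graph, an enumeration algorithm must, for some single spanning tree $T$ of the graph, emit each edge of $T$ exactly once. Its delay is the maximum time the algorithm needs to emit the respective next edge; preprocessing time is additional time spent before emitting the first edge. "Without preprocessing" means that the first edge is also emitted within the delay bound. -}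

module Defs where

open import Data.Bool using (Bool; true; false; if_then_else_)
open import Data.Fin using (Fin; toℕ; fromℕ<)
open import Data.Integer using (+_)
open import Data.List using (List; []; _∷_; _∷ʳ_; allFin; drop; head; length; map)
open import Data.List.Membership.Propositional using (_∈_)
open import Data.List.Relation.Unary.All using (All)
open import Data.List.Relation.Unary.AllPairs using (AllPairs)
open import Data.List.Relation.Unary.Any using (Any)
open import Data.List.Relation.Unary.Linked using (Linked)
open import Data.List.Relation.Unary.Unique.Propositional using (Unique)
open import Data.Maybe using (Maybe; just; nothing; _>>=_)
open import Data.Nat using (ℕ; zero; suc; _+_; _*_; _∸_; _^_; _≤_; _<ᵇ_; _≡ᵇ_; _<?_; NonZero)
open import Data.Nat.DivMod using (_/_; _%_)
open import Data.Nat.ListAction using (sum)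
open import Data.Nat.Properties using (m^n≢0)
open import Data.Product using (_×_; _,_; uncurry)
open import Data.Rational.Unnormalised as ℚ using (ℚᵘ)
open import Data.Sum using (_⊎_)
open import Data.Vec as Vec using (Vec; lookup; _[_]≔_; replicate)
open import Function using (_⇔_)
open import Level using (0ℓ)
open import Relation.Binary using (Rel; _⇒_)
open import Relation.Binary.Construct.Closure.ReflexiveTransitive using (Star)
open import Relation.Binary.PropositionalEquality using (_≡_)
open import Relation.Nullary using (¬_; yes; no)

------------------------------------------------------------------------
-- Graphs and spanning trees

record Graph (n : ℕ) : Set₁ where
  field
    Edge    : Rel (Fin n) 0ℓ
    symm    : ∀ {u v} → Edge u v → Edge v u
    irrefl  : ∀ {v} → ¬ Edge v v

open Graph public

Connected : ∀ {n} → Graph n → Set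
Connected G = ∀ u v → Star (Edge G) u v

-- The cycle v, vs₁, …, vsₖ, v; k ≥ 2 excludes walking back along one edge.
IsCycle : ∀ {n} → Graph n → Fin n → List (Fin n) → Set
IsCycle G v vs = 2 ≤ length vs × Unique (v ∷ vs) × Linked (Edge G) (v ∷ vs ∷ʳ v)

Acyclic : ∀ {n} → Graph n → Set
Acyclic G = ∀ v vs → ¬ IsCycle G v vs

record IsSpanningTree {n} (G T : Graph n) : Set where
  field
    subgraph  : Edge T ⇒ Edge G
    connected : Connected T
    acyclic   : Acyclic T

-- A pair of endpoints stands for an undirected edge.
_≈ₑ_ : ∀ {n} → Rel (Fin n × Fin n) 0ℓ
(u , v) ≈ₑ (x , y) = (u ≡ x × v ≡ y) ⊎ (u ≡ y × v ≡ x)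

record ListsEachEdgeOnce {n} (T : Graph n) (es : List (Fin n × Fin n)) : Set where
  field
    sound      : All (uncurry (Edge T)) es
    complete   : ∀ u v → Edge T u v → Any ((u , v) ≈ₑ_) es
    noRepeats  : AllPairs (λ e f → ¬ e ≈ₑ f) es

record AdjacencyLists {n} (G : Graph n) : Set where
  field
    adj      : Fin n → List (Fin n)
    unique   : ∀ v → Unique (adj v)
    correct  : ∀ u v → v ∈ adj u ⇔ Edge G u v

  deg : Fin n → ℕ
  deg v = length (adj v)

  averageDegree : .{{_ : NonZero n}} → ℚᵘ
  averageDegree = + sum (map deg (allFin n)) ℚ./ n

open AdjacencyLists public

------------------------------------------------------------------------
-- Word RAM programs

data BlockKind : Set where
  lazyInit uninit : BlockKind

data Op : Set where
  add sub mul div mod : Op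

data Cmp : Set where
  lt eq : Cmp

Label : Set
Label = ℕ

-- Instructions over r registers and b memory blocks; in those that
-- produce a value, the first argument is the target register.  The
-- instruction set is kept small: the result asserts that a program
-- exists, so further instructions would only make it weaker.
data Instr (r b : ℕ) : Set where
  const    : Fin r → ℕ → Instr r b
  move     : Fin r → Fin r → Instr r b
  arith    : Op → Fin r → Fin r → Fin r → Instr r b
  jump     : Label → Instr r b
  jumpIf   : Cmp → Fin r → Fin r → Label → Instr r b
  jumpNil  : Fin r → Label → Instr r b
  reserve  : Fin b → Fin r → Instr r b
  load     : Fin r → Fin b → Fin r → Instr r b
  store    : Fin b → Fin r → Fin r → Instr r b
  order    : Fin r → Instr r b
  degree   : Fin r → Fin r → Instr r b
  first    : Fin r → Fin r → Instr r b
  target   : Fin r → Fin r → Instr r b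
  next     : Fin r → Fin r → Instr r b
  emit     : Fin r → Fin r → Instr r b
  halt     : Instr r b

record Program : Set where
  field
    registers : ℕ
    blocks    : ℕ
    kinds     : Vec BlockKind blocks
    code      : List (Instr registers blocks)

open Program public

------------------------------------------------------------------------
-- Execution

-- A memory cell holds a machine word or a reference to a node of one of
-- the (linked, read-only) adjacency lists.  Such a node is represented by
-- the part of the list that starts there, [] being the null reference.
data Value (n : ℕ) : Set where
  word : ℕ → Value n
  ref  : List (Fin n) → Value n

truncate : (w : ℕ) → ℕ → ℕ
truncate w x = _%_ x (2 ^ w) {{m^n≢0 2 w}}

applyOp : (w : ℕ) → Op → ℕ → ℕ → Maybe ℕ
applyOp w add x y       = just (truncate w (x + y))
applyOp w sub x y       = just (truncate w (x + (2 ^ w ∸ y)))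
applyOp w mul x y       = just (truncate w (x * y))
applyOp w div x zero    = nothing
applyOp w div x (suc y) = just (x / suc y)
applyOp w mod x zero    = nothing
applyOp w mod x (suc y) = just (x % suc y)

test : Cmp → ℕ → ℕ → Bool
test lt = _<ᵇ_
test eq = _≡ᵇ_

asWord : ∀ {n} → Value n → Maybe ℕ
asWord (word x) = just x
asWord (ref _)  = nothing

asVertex : ∀ {n} → Value n → Maybe (Fin n)
asVertex (ref _)      = nothing
asVertex {n} (word x) with x <? n
... | yes x<n = just (fromℕ< x<n)
... | no  _   = nothing

asNode : ∀ {n} → Value n → Maybe (List (Fin n))
asNode (word _) = nothing
asNode (ref p)  = just p

-- Block i consists of the cells 0, …, lookup sizes i ∸ 1; a block that
-- has not been reserved has size 0.
record State (P : Program) (n : ℕ) : Set where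
  constructor mkState
  field
    pc    : Label
    regs  : Vec (Value n) (registers P)
    sizes : Vec ℕ (blocks P)
    cells : Fin (blocks P) → ℕ → Value n

open State public

data Effect (P : Program) (n : ℕ) : Set where
  halted   : Effect P n
  silent   : State P n → Effect P n
  emitting : Fin n × Fin n → State P n → Effect P n

-- The program P on the input given by adjacency lists, with word size w.
-- Words are the numbers below 2 ^ w.  Vertices, degrees and n are used as
-- words untruncated, so the model is meant for n < 2 ^ w; this is the
-- requirement that the word size be in Ω(log n), with one cell per vertex.
module Run (P : Program) {n} {G : Graph n} (A : AdjacencyLists G) (w : ℕ) where

  b : ℕ
  b = blocks P

  Register : Set
  Register = Fin (registers P)

  goto : Label → State P n → State P n
  goto l s = record s { pc = l }

  advance : State P n → State P n
  advance s = goto (suc (pc s)) s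

  assign : Register → Value n → State P n → Effect P n
  assign r x s = silent (advance (record s { regs = regs s [ r ]≔ x }))

  setCell : Fin b → ℕ → Value n → (Fin b → ℕ → Value n) → Fin b → ℕ → Value n
  setCell i a x m j c =
    if toℕ j ≡ᵇ toℕ i then (if c ≡ᵇ a then x else m j c) else m j c

  checked : ∀ {X : Set} → Bool → X → Maybe X
  checked c x = if c then just x else nothing

  -- nothing: the program has crashed.
  exec : Instr (registers P) b → State P n → Maybe (Effect P n)
  exec (const r k) s = just (assign r (word (truncate w k)) s)
  exec (move r q) s = just (assign r (lookup (regs s) q) s)
  exec (arith o r q q′) s =
    asWord (lookup (regs s) q)  >>= λ x →
    asWord (lookup (regs s) q′) >>= λ y →
    applyOp w o x y             >>= λ z →
    just (assign r (word z) s)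
  exec (jump l) s = just (silent (goto l s))
  exec (jumpIf c q q′ l) s =
    asWord (lookup (regs s) q)  >>= λ x →
    asWord (lookup (regs s) q′) >>= λ y →
    just (silent (if test c x y then goto l s else advance s))
  exec (jumpNil q l) s =
    asNode (lookup (regs s) q) >>= λ where
      []      → just (silent (goto l s))
      (_ ∷ _) → just (silent (advance s))
  -- Each block can be reserved once, and is never released.
  exec (reserve i q) s =
    asWord (lookup (regs s) q) >>= λ k →
    checked (lookup (sizes s) i ≡ᵇ 0)
      (silent (advance (record s { sizes = sizes s [ i ]≔ k })))
  exec (load r i q) s =
    asWord (lookup (regs s) q) >>= λ a →
    checked (a <ᵇ lookup (sizes s) i) (assign r (cells s i a) s)
  exec (store i q q′) s =
    asWord (lookup (regs s) q) >>= λ a →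
    checked (a <ᵇ lookup (sizes s) i)
      (silent (advance (record s
        { cells = setCell i a (lookup (regs s) q′) (cells s) })))
  exec (order r) s = just (assign r (word n) s)
  exec (degree r q) s =
    asVertex (lookup (regs s) q) >>= λ v →
    just (assign r (word (deg A v)) s)
  exec (first r q) s =
    asVertex (lookup (regs s) q) >>= λ v →
    just (assign r (ref (adj A v)) s)
  exec (target r q) s =
    asNode (lookup (regs s) q) >>= λ where
      []      → nothing
      (v ∷ _) → just (assign r (word (toℕ v)) s)
  exec (next r q) s =
    asNode (lookup (regs s) q) >>= λ where
      []      → nothing
      (_ ∷ p) → just (assign r (ref p) s)
  exec (emit q q′) s =
    asVertex (lookup (regs s) q)  >>= λ u →
    asVertex (lookup (regs s) q′) >>= λ v →
    just (emitting (u , v) (advance s))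
  exec halt s = just halted

  step : State P n → Maybe (Effect P n)
  step s = head (drop (pc s) (code P)) >>= λ i → exec i s

  -- Lazily initialized blocks read as 0 where they have not been written;
  -- the others start out with the arbitrary words in garbage.
  initial : (garbage : Fin b → ℕ → ℕ) → State P n
  initial garbage = mkState 0 (replicate _ (word 0)) (replicate _ 0) contents
    where
    contents : Fin b → ℕ → Value n
    contents i a with lookup (kinds P) i
    ... | lazyInit = word 0
    ... | uninit   = word (truncate w (garbage i a))

  data SilentSteps : ℕ → State P n → State P n → Set where
    done : ∀ {s} → SilentSteps 0 s s
    _∷_  : ∀ {k s s′ s″} → step s ≡ just (silent s′) → SilentSteps k s′ s″ →
           SilentSteps (suc k) s s″

  -- Enumerates D s es f: started in s, the program emits exactly es, each
  -- edge at most D steps after its predecessor (the first one at most D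
  -- steps after the start), and then halts in f.
  data Enumerates (D : ℚᵘ) : State P n → List (Fin n × Fin n) → State P n → Set where
    halts : ∀ {k s f} → SilentSteps k s f → step f ≡ just halted →
            Enumerates D s [] f
    emits : ∀ {k s s′ s″ f e es} →
            SilentSteps k s s′ → step s′ ≡ just (emitting e s″) →
            (+ suc k ℚ./ 1) ℚ.≤ D →
            Enumerates D s″ es f →
            Enumerates D s (e ∷ es) f

open Run public using (initial; Enumerates)

------------------------------------------------------------------------
-- Memory usage, in cells.  Blocks are never released, so the values in
-- the final state of a run are those of the whole run.

lazySize : BlockKind → ℕ → ℕ
lazySize lazyInit k = k
lazySize uninit   k = 0

lazyMemory : ∀ {P n} → State P n → ℕ
lazyMemory {P} s = Vec.sum (Vec.zipWith lazySize (kinds P) (sizes s))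

space : ∀ {P n} → State P n → ℕ
space {P} s = registers P + Vec.sum (sizes s)

-- x ∈ Θ(n) with constant c, in both directions.
Θ[_] : ℕ → ℕ → ℕ → Set
Θ[ c ] x n = n ≤ c * x × x ≤ c * n

{-# OPTIONS --safe #-}
module Submission where

-- The first phase runs through the vertices; a vertex v without label is joined to its first
-- neighbour, which gets a label too if it has none.  After k vertices at least k / 2 edges of a
-- forest are thus known, and emitting one edge per four vertices never exhausts the queue.  In
-- passing, L = ⌊2m / n⌋ is computed.  The second phase is a graph search that starts in the
-- component of vertex 0 and enters a whole component at a time.  It reads 2m < n (L + 1) adjacency
-- entries and emits one edge per 4 (L + 1) of them, hence at most n / 4 edges, whereas at least
-- n / 4 edges of the first phase are still waiting.  What is left in the end is flushed.  The
-- members of a component form a circular linked list, so that exchanging the successors of two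
-- vertices merges their components.  The delay is O(L + 1), which is O(L) as every vertex has a
-- neighbour when n ≥ 2.

open import Defs
open import Data.Bool using (T; false; if_then_else_; true)
open import Data.Fin using (#_; Fin; _≟_; fromℕ<; suc; toℕ; zero)
open import Data.Fin.Properties using (fromℕ<-toℕ; toℕ-fromℕ<; toℕ-injective; toℕ<n)
open import Data.Integer as ℤ using (+_)
open import Data.Integer.Properties using (pos-*)
open import Data.List as List using (List; []; _++_; _∷_; _∷ʳ_; allFin; drop; length; map; take)
open import Data.List.Membership.Propositional using (_∈_; _∉_)
open import Data.List.Membership.Propositional.Properties using (∈-++⁺ʳ; ∈-++⁺ˡ; ∈-++⁻; ∈-allFin; ∈-∃++)
open import Data.List.Properties using (++-assoc; ++-identityʳ; length-++; length-tabulate; length-take; map-++; take-all; take-suc-tabulate)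
open import Data.List.Relation.Binary.Permutation.Propositional using (_↭_; prep; ↭-reflexive; ↭-sym; ↭-trans; ↭⇒↭ₛ)
open import Data.List.Relation.Binary.Permutation.Propositional.Properties using (map⁺; shift; ∈-resp-↭)
import Data.List.Relation.Binary.Permutation.Setoid.Properties as Permₛ
open import Data.List.Relation.Unary.All as All using (All; []; _∷_)
import Data.List.Relation.Unary.All.Properties as All
open import Data.List.Relation.Unary.AllPairs as AllPairs using (AllPairs; []; _∷_)
import Data.List.Relation.Unary.AllPairs.Properties as AllPairs
open import Data.List.Relation.Unary.Any as Any using (Any; here; there)
import Data.List.Relation.Unary.Any.Properties as Any
open import Data.List.Relation.Unary.Linked using (Linked; [-]; []; _∷_)
open import Data.List.Relation.Unary.Unique.Propositional using (Unique)
import Data.List.Relation.Unary.Unique.Propositional.Properties as Unique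
open import Data.Maybe using (just)
open import Data.Nat using (NonZero; _*_; _+_; _<?_; _<_; _<ᵇ_; _^_; _∸_; _≡ᵇ_; _≤_; _⊓_; suc; s≤s; zero; z≤n; ℕ)
open import Data.Nat.DivMod using ([m+n]%n≡m%n; _%_; _/_; m%n<n; m<n⇒m%n≡m; m≡m%n+[m/n]*n)
open import Data.Nat.ListAction using (sum)
open import Data.Nat.ListAction.Properties using (sum-++; sum-↭)
open import Data.Nat.Properties hiding (_≟_)
open import Data.Nat.Tactic.RingSolver using (solve-∀)
open import Data.Product using (_,_; _×_; proj₁; proj₂; uncurry; ∃-syntax)
open import Data.Rational.Unnormalised as ℚ using (ℚᵘ)
open import Data.Sum using (_⊎_; inj₁; inj₂)
open import Data.Unit using (tt; ⊤)
open import Data.Vec using ([]; _[_]≔_; _∷_; lookup; replicate)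
open import Function using (Equivalence; _∘_; id)
open import Level using (0ℓ)
open import Relation.Binary using (Rel)
open import Relation.Binary.Construct.Closure.ReflexiveTransitive as Star using (Star; _◅_; _◅◅_; ε)
open import Relation.Binary.PropositionalEquality
open import Relation.Nullary using (Dec; contradiction; does; no; yes; ¬_)

-- Some first-phase edges have been emitted before the search begins, so the search cannot pick a
-- tree of its own: it has to extend a given forest, and therefore works on components instead of
-- vertices. One clock paces both phases, with an emission every `4 * suc limit` pacing steps. While
-- `L` is unknown, `limit` is 0 and a turn stands for one vertex; once `limit` is `L`, a turn stands
-- for `suc L` adjacency entries. All accounts use this exchange rate: a scanned vertex is credited
-- with `suc L` ticks. Merging in constant time takes no general union-find structure. The first
-- phase only ever attaches single vertices, and in the second phase every merge is into the one
-- component of the root. Correctness does not depend on the moment of emission: the edges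
-- `sent ++ pend` found so far are a forest, and emitting moves an edge from `pend` to `sent`. Fewer
-- than `n` edges are ever found, so `n` cells hold the queue without reuse.

-- Counting in lists without repetition.

Unique-resp-↭ : ∀ {A : Set} {xs ys : List A} → xs ↭ ys → Unique xs → Unique ys
Unique-resp-↭ p = Permₛ.Unique-resp-↭ (setoid _) (↭⇒↭ₛ p)

Unique-head : ∀ {A : Set} {x : A} {xs} → Unique (x ∷ xs) → x ∉ xs
Unique-head = Unique.Unique[x∷xs]⇒x∉xs

-- Each head of `xs` is cut out of `ys`; as it does not recur in `xs`, the tail still fits into what
-- remains. Weight 1 bounds lengths, weight `deg` bounds the adjacency entries read.
sum-map-mono-⊆ : ∀ {A : Set} (f : A → ℕ) {xs ys} → Unique xs → (∀ {z} → z ∈ xs → z ∈ ys) →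
                 sum (map f xs) ≤ sum (map f ys)
sum-map-mono-⊆ f {[]} _ _ = z≤n
sum-map-mono-⊆ f {x ∷ xs} uniq@(_ ∷ uniq′) xs⊆ys with ∈-∃++ (xs⊆ys (here refl))
... | as , bs , refl = begin
  f x + sum (map f xs)          ≤⟨ +-monoʳ-≤ (f x) (sum-map-mono-⊆ f uniq′ rest) ⟩
  f x + sum (map f (as ++ bs))  ≡⟨ sum-↭ (map⁺ f (shift x as bs)) ⟨
  sum (map f (as ++ x ∷ bs))    ∎
  where
  open ≤-Reasoning
  rest : ∀ {z} → z ∈ xs → z ∈ as ++ bs
  rest z∈xs with ∈-resp-↭ (shift x as bs) (xs⊆ys (there z∈xs))
  ... | here refl = contradiction z∈xs (Unique-head uniq)
  ... | there z∈  = z∈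

sum-map-1 : ∀ {A : Set} (xs : List A) → sum (map (λ _ → 1) xs) ≡ length xs
sum-map-1 []       = refl
sum-map-1 (_ ∷ xs) = cong suc (sum-map-1 xs)

length-mono-⊆ : ∀ {A : Set} {xs ys : List A} → Unique xs → (∀ {z} → z ∈ xs → z ∈ ys) →
                length xs ≤ length ys
length-mono-⊆ {xs = xs} {ys} uniq xs⊆ys =
  subst₂ _≤_ (sum-map-1 xs) (sum-map-1 ys) (sum-map-mono-⊆ (λ _ → 1) uniq xs⊆ys)

length-Unique≤ : ∀ {n} {xs : List (Fin n)} → Unique xs → length xs ≤ n
length-Unique≤ {n} {xs} uniq =
  subst (length xs ≤_) (length-tabulate {n = n} id) (length-mono-⊆ uniq (λ {z} _ → ∈-allFin z))

-- Cycles, and adding an edge between two classes.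

end : ∀ {A : Set} → A → List A → A
end x []       = x
end x (y ∷ ys) = end y ys

end∈ : ∀ {A : Set} (x : A) xs → end x xs ∈ x ∷ xs
end∈ x []       = here refl
end∈ x (y ∷ ys) = there (end∈ y ys)

Linked-∷ʳ⁻ : ∀ {A : Set} {R : Rel A 0ℓ} x xs {v} → Linked R (x ∷ xs ∷ʳ v) →
             Linked R (x ∷ xs) × R (end x xs) v
Linked-∷ʳ⁻ x []       (r ∷ [-]) = [-] , r
Linked-∷ʳ⁻ x (y ∷ ys) (r ∷ rs) with Linked-∷ʳ⁻ y ys rs
... | ls , l = r ∷ ls , l

Linked-∷ʳ⁺ : ∀ {A : Set} {R : Rel A 0ℓ} x xs {v} → Linked R (x ∷ xs) → R (end x xs) v →
             Linked R (x ∷ xs ∷ʳ v)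
Linked-∷ʳ⁺ x []       [-]      l = l ∷ [-]
Linked-∷ʳ⁺ x (y ∷ ys) (r ∷ rs) l = r ∷ Linked-∷ʳ⁺ y ys rs l

Cycle : ∀ {n} → Rel (Fin n) 0ℓ → Fin n → List (Fin n) → Set
Cycle E v vs = 2 ≤ length vs × Unique (v ∷ vs) × Linked E (v ∷ vs ∷ʳ v)

-- E′ consists of E and the edge ab, whose ends lie in different classes of
-- C, while E stays within classes.  A simple path uses ab at most once, so
-- it changes classes as soon as it uses ab.
module NewEdge {n} {E E′ : Rel (Fin n) 0ℓ} (C : Fin n → Fin n) {a b : Fin n}
  (within : ∀ {u v} → E u v → C u ≡ C v) (Ca≢Cb : C a ≢ C b)
  (split : ∀ {u v} → E′ u v → E u v ⊎ (u , v) ≈ₑ (a , b)) where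

  crosses : ∀ {u v} → (u , v) ≈ₑ (a , b) → C u ≢ C v
  crosses (inj₁ (refl , refl)) = Ca≢Cb
  crosses (inj₂ (refl , refl)) = Ca≢Cb ∘ sym

  Linked-within : ∀ z zs → Linked E (z ∷ zs) → C z ≡ C (end z zs)
  Linked-within z []       _        = refl
  Linked-within z (y ∷ ys) (e ∷ es) = trans (within e) (Linked-within y ys es)

  -- The crossing case records that both ends of `ab` lie on the path. This excludes a second use:
  -- the vertex in front would be `a` or `b` and occur twice.
  path : ∀ z zs → Unique (z ∷ zs) → Linked E′ (z ∷ zs) →
         Linked E (z ∷ zs) ⊎ (C z ≢ C (end z zs) × a ∈ z ∷ zs × b ∈ z ∷ zs)
  path z []       _             _        = inj₁ [-]
  path z (y ∷ ys) uniq@(_ ∷ u′) (e ∷ es) with split e | path y ys u′ es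
  ... | inj₁ zy | inj₁ l              = inj₁ (zy ∷ l)
  ... | inj₁ zy | inj₂ (p≢ , a∈ , b∈) = inj₂ (p≢ ∘ trans (sym (within zy)) , there a∈ , there b∈)
  ... | inj₂ ab | inj₁ l              = inj₂ (crosses ab ∘ (λ p≡ → trans p≡ (sym (Linked-within y ys l))) , ends ab)
    where
    ends : (z , y) ≈ₑ (a , b) → a ∈ z ∷ y ∷ ys × b ∈ z ∷ y ∷ ys
    ends (inj₁ (refl , refl)) = here refl , there (here refl)
    ends (inj₂ (refl , refl)) = there (here refl) , here refl
  ... | inj₂ (inj₁ (refl , _)) | inj₂ (_ , a∈ , _) = contradiction a∈ (Unique-head uniq)
  ... | inj₂ (inj₂ (refl , _)) | inj₂ (_ , _ , b∈) = contradiction b∈ (Unique-head uniq)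

  -- The two edges at `v` are split off. If the remaining path avoids `ab`, then no use of `ab`
  -- gives a cycle of `E`, one use changes class without a return, and two uses make the path end
  -- where it starts. If the path uses `ab`, then `v` is no end of `ab`, so both edges at `v` stay
  -- within a class whereas the ends of the path differ in class.
  acyclic : (∀ v vs → ¬ Cycle E v vs) → ∀ v vs → ¬ Cycle E′ v vs
  acyclic ac v (x ∷ [])     (s≤s () , _)
  acyclic ac v (x ∷ y ∷ ys) (2≤ , uniq@(_ ∷ uniq′) , e ∷ es)
    with Linked-∷ʳ⁻ x (y ∷ ys) es
  ... | p , l with path x (y ∷ ys) uniq′ p | split e | split l
  ... | inj₁ q | inj₁ e₁ | inj₁ l₁ = ac v (x ∷ y ∷ ys) (2≤ , uniq , e₁ ∷ Linked-∷ʳ⁺ x (y ∷ ys) q l₁)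
  ... | inj₁ q | inj₁ e₁ | inj₂ l₂ = crosses l₂ (sym (trans (within e₁) (Linked-within x (y ∷ ys) q)))
  ... | inj₁ q | inj₂ e₂ | inj₁ l₁ = crosses e₂ (sym (trans (Linked-within x (y ∷ ys) q) (within l₁)))
  ... | inj₁ q | inj₂ e₂ | inj₂ l₂ = Unique-head uniq′ (subst (_∈ y ∷ ys) (same e₂ l₂) (end∈ y ys))
    where
    same : ∀ {t} → (v , x) ≈ₑ (a , b) → (t , v) ≈ₑ (a , b) → t ≡ x
    same (inj₁ (refl , refl)) (inj₁ (refl , p≡)) = contradiction (cong C p≡) Ca≢Cb
    same (inj₁ (refl , refl)) (inj₂ (refl , _))  = refl
    same (inj₂ (refl , refl)) (inj₁ (refl , _))  = refl
    same (inj₂ (refl , refl)) (inj₂ (refl , p≡)) = contradiction (cong C (sym p≡)) Ca≢Cb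
  ... | inj₂ (p≢ , a∈ , b∈) | e′ | l′ = p≢ (sym (trans (within (after l′)) (within (before e′))))
    where
    before : E v x ⊎ (v , x) ≈ₑ (a , b) → E v x
    before (inj₁ e₁) = e₁
    before (inj₂ (inj₁ (refl , _))) = contradiction a∈ (Unique-head uniq)
    before (inj₂ (inj₂ (refl , _))) = contradiction b∈ (Unique-head uniq)
    after : E (end y ys) v ⊎ (end y ys , v) ≈ₑ (a , b) → E (end y ys) v
    after (inj₁ l₁) = l₁
    after (inj₂ (inj₁ (_ , refl))) = contradiction b∈ (Unique-head uniq)
    after (inj₂ (inj₂ (_ , refl))) = contradiction a∈ (Unique-head uniq)

-- Forests and their classes.

relabel : ∀ {n} → (Fin n → Fin n) → Fin n → Fin n → Fin n → Fin n
relabel C k r z = if does (C z ≟ k) then r else C z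

module Relabel {n} (C : Fin n → Fin n) (k r : Fin n) where

  relabel-hit : ∀ {z} → C z ≡ k → relabel C k r z ≡ r
  relabel-hit {z} p≡ with C z ≟ k
  ... | yes _ = refl
  ... | no p≢ = contradiction p≡ p≢

  relabel-miss : ∀ {z} → C z ≢ k → relabel C k r z ≡ C z
  relabel-miss {z} p≢ with C z ≟ k
  ... | yes p≡ = contradiction p≡ p≢
  ... | no _   = refl

  relabel-cong : ∀ {y z} → C y ≡ C z → relabel C k r y ≡ relabel C k r z
  relabel-cong p≡ rewrite p≡ = refl

  relabel-cases : ∀ z → (C z ≡ k × relabel C k r z ≡ r) ⊎ (C z ≢ k × relabel C k r z ≡ C z)
  relabel-cases z with C z ≟ k
  ... | yes p≡ = inj₁ (p≡ , refl)
  ... | no p≢  = inj₂ (p≢ , refl)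

Joined : ∀ {n} → List (Fin n × Fin n) → Rel (Fin n) 0ℓ
Joined es u v = Any ((u , v) ≈ₑ_) es

≈ₑ-swap : ∀ {n} {u v : Fin n} {e} → (u , v) ≈ₑ e → (v , u) ≈ₑ e
≈ₑ-swap (inj₁ (p , q)) = inj₂ (q , p)
≈ₑ-swap (inj₂ (p , q)) = inj₁ (q , p)

≈ₑ-sym : ∀ {n} {d e : Fin n × Fin n} → d ≈ₑ e → e ≈ₑ d
≈ₑ-sym (inj₁ (refl , refl)) = inj₁ (refl , refl)
≈ₑ-sym (inj₂ (refl , refl)) = inj₂ (refl , refl)

Joined-∷ʳ⁻ : ∀ {n} (es : List (Fin n × Fin n)) {e u v} → Joined (es ∷ʳ e) u v →
             Joined es u v ⊎ (u , v) ≈ₑ e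
Joined-∷ʳ⁻ es j with Any.++⁻ es j
... | inj₁ i        = inj₁ i
... | inj₂ (here p) = inj₂ p

-- The edges es form a forest whose trees are the classes of C, each named
-- by one of its vertices.  A merged tree loses its name; lost records those names.
record Forest {n} (G : Graph n) (es : List (Fin n × Fin n)) (C : Fin n → Fin n) : Set where
  field
    idem     : ∀ z → C (C z) ≡ C z
    inGraph  : All (uncurry (Edge G)) es
    within   : ∀ {u v} → Joined es u v → C u ≡ C v
    linked   : ∀ z → Star (Joined es) z (C z)
    acyclic  : ∀ v vs → ¬ Cycle (Joined es) v vs
    distinct : AllPairs (λ e f → ¬ e ≈ₑ f) es
    lost     : ∃[ K ] (Unique K × All (λ z → C z ≢ z) K × length K ≡ length es)

discrete : ∀ {n} (G : Graph n) → Forest G [] id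
discrete G = record
  { idem     = λ _ → refl
  ; inGraph  = []
  ; within   = λ ()
  ; linked   = λ _ → ε
  ; acyclic  = λ { _ [] (() , _) ; _ (_ ∷ _) (_ , _ , () ∷ _) }
  ; distinct = []
  ; lost     = [] , [] , [] , refl
  }

module _ {n} {G : Graph n} {es : List (Fin n × Fin n)} {C : Fin n → Fin n} (F : Forest G es C) where

  open Forest F

  -- The lost names and the surviving name `k` are distinct vertices. This is what keeps `tail`
  -- inside the queue blocks.
  length-Forest< : ∀ {k} → C k ≡ k → length es < n
  length-Forest< {k} Ck≡k with lost
  ... | K , uniq , moved , len = subst (_< n) len
    (length-Unique≤ (All.map (λ Cz≢z k≡z → Cz≢z (subst (λ z → C z ≡ z) k≡z Ck≡k)) moved ∷ uniq))

  -- The class of `b` takes over the name of the class of `a`, so callers put the end whose name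
  -- survives first. The name `C b` is the one newly lost.
  Forest-∷ʳ : ∀ {a b} → Edge G a b → C a ≢ C b → Forest G (es ∷ʳ (a , b)) (relabel C (C b) (C a))
  Forest-∷ʳ {a} {b} ab Ca≢Cb = record
    { idem     = idem′
    ; inGraph  = All.∷ʳ⁺ inGraph ab
    ; within   = within′ ∘ Joined-∷ʳ⁻ es
    ; linked   = linked′
    ; acyclic  = NewEdge.acyclic C within Ca≢Cb (Joined-∷ʳ⁻ es) acyclic
    ; distinct = AllPairs.++⁺ distinct ([] ∷ [])
                   (All.tabulate (λ {(x , y)} e∈ → (λ e≈ab →
                     Ca≢Cb (within (Any.map (λ { refl → ≈ₑ-sym e≈ab }) e∈))) ∷ []))
    ; lost     = lost′
    }
    where
    open Relabel C (C b) (C a)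

    C′ : Fin n → Fin n
    C′ = relabel C (C b) (C a)

    C′-a : C′ (C a) ≡ C a
    C′-a = trans (relabel-miss (Ca≢Cb ∘ trans (sym (idem a)))) (idem a)

    idem′ : ∀ z → C′ (C′ z) ≡ C′ z
    idem′ z with relabel-cases z
    ... | inj₁ (_ , p≡) rewrite p≡ = C′-a
    ... | inj₂ (p≢ , p≡) rewrite p≡ = trans (relabel-miss (p≢ ∘ trans (sym (idem z)))) (idem z)

    within′ : ∀ {u v} → Joined es u v ⊎ (u , v) ≈ₑ (a , b) → C′ u ≡ C′ v
    within′ (inj₁ j) = relabel-cong (within j)
    within′ (inj₂ (inj₁ (refl , refl))) = trans (relabel-miss Ca≢Cb) (sym (relabel-hit refl))
    within′ (inj₂ (inj₂ (refl , refl))) = trans (relabel-hit refl) (sym (relabel-miss Ca≢Cb))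

    old : ∀ {u v} → Star (Joined es) u v → Star (Joined (es ∷ʳ (a , b))) u v
    old = Star.map Any.++⁺ˡ

    joined-sym : ∀ {u v} → Joined es u v → Joined es v u
    joined-sym = Any.map ≈ₑ-swap

    linked′ : ∀ z → Star (Joined (es ∷ʳ (a , b))) z (C′ z)
    linked′ z with relabel-cases z
    ... | inj₂ (_ , p≡) = subst (Star _ z) (sym p≡) (old (linked z))
    ... | inj₁ (Cz≡Cb , p≡) = subst (Star _ z) (sym p≡)
      (old (subst (Star _ z) Cz≡Cb (linked z) ◅◅ Star.reverse joined-sym (linked b))
        ◅◅ Any.++⁺ʳ es (here (inj₂ (refl , refl))) ◅ old (linked a))

    lost′ : ∃[ K ] (Unique K × All (λ z → C′ z ≢ z) K × length K ≡ length (es ∷ʳ (a , b)))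
    lost′ with lost
    ... | K , uniq , moved , len =
      C b ∷ K ,
      All.map (λ Cz≢z Cb≡z → Cz≢z (subst (λ z → C z ≡ z) Cb≡z (idem b))) moved ∷ uniq ,
      (λ p≡ → Ca≢Cb (trans (sym (relabel-hit (idem b))) p≡)) ∷ All.map still moved ,
      trans (cong suc len) (trans (+-comm 1 _) (sym (length-++ es)))
      where
      -- `C′ z` is `C z` or the old name `C a`, so a fixed point of `C′` was one of `C`.
      still : ∀ {z} → C z ≢ z → C′ z ≢ z
      still {z} Cz≢z C′z≡z with relabel-cases z
      ... | inj₂ (_ , p≡) = Cz≢z (trans (sym p≡) C′z≡z)
      ... | inj₁ (_ , p≡) = Cz≢z (subst (λ z → C z ≡ z) (trans (sym p≡) C′z≡z) (idem a))

  graph : Graph n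
  graph = record
    { Edge   = Joined es
    ; symm   = Any.map ≈ₑ-swap
    ; irrefl = λ j → loopless inGraph j
    }
    where
    loopless : ∀ {fs v} → All (uncurry (Edge G)) fs → ¬ Joined fs v v
    loopless (e ∷ _)  (here (inj₁ (refl , refl))) = irrefl G e
    loopless (e ∷ _)  (here (inj₂ (refl , refl))) = irrefl G e
    loopless (_ ∷ fs) (there j) = loopless fs j

  spanning : (∀ u v → C u ≡ C v) → IsSpanningTree G graph
  spanning one = record
    { subgraph  = inG inGraph
    ; connected = λ u v → linked u ◅◅ subst (λ c → Star _ c v) (one v u) (Star.reverse (symm graph) (linked v))
    ; acyclic   = acyclic
    }
    where
    inG : ∀ {fs u v} → All (uncurry (Edge G)) fs → Joined fs u v → Edge G u v
    inG (e ∷ _)  (here (inj₁ (refl , refl))) = e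
    inG (e ∷ _)  (here (inj₂ (refl , refl))) = symm G e
    inG (_ ∷ es) (there j) = inG es j

  listed : ListsEachEdgeOnce graph es
  listed = record
    { sound     = All.tabulate (Any.map (λ { refl → inj₁ (refl , refl) }))
    ; complete  = λ _ _ j → j
    ; noRepeats = distinct
    }

-- Components as circular lists, and their merging.

infixl 9 _[_↦_]

_[_↦_] : ∀ {n} {A : Set} → (Fin n → A) → Fin n → A → Fin n → A
(f [ a ↦ x ]) z = if does (z ≟ a) then x else f z

module _ {n} {A : Set} (f : Fin n → A) (a : Fin n) {x : A} where

  update-hit : ∀ {z} → z ≡ a → (f [ a ↦ x ]) z ≡ x
  update-hit {z} p with z ≟ a
  ... | yes _ = refl
  ... | no p≢ = contradiction p p≢

  update-miss : ∀ {z} → z ≢ a → (f [ a ↦ x ]) z ≡ f z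
  update-miss {z} p≢ with z ≟ a
  ... | yes p = contradiction p p≢
  ... | no _  = refl

exchange : ∀ {n} {A : Set} → (Fin n → A) → Fin n → Fin n → Fin n → A
exchange f a b = f [ a ↦ f b ] [ b ↦ f a ]

module _ {n} {A : Set} (f : Fin n → A) {a b : Fin n} (a≢b : a ≢ b) where

  exchange-left : exchange f a b a ≡ f b
  exchange-left = trans (update-miss (f [ a ↦ f b ]) b a≢b) (update-hit f a refl)

  exchange-right : exchange f a b b ≡ f a
  exchange-right = update-hit (f [ a ↦ f b ]) b refl

  exchange-other : ∀ {z} → z ≢ a → z ≢ b → exchange f a b z ≡ f z
  exchange-other z≢a z≢b = trans (update-miss (f [ a ↦ f b ]) b z≢b) (update-miss f a z≢a)

record Members {n} (C : Fin n → Fin n) (r : Fin n) (L : List (Fin n)) : Set where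
  field
    unique   : Unique L
    sound    : ∀ {z} → z ∈ L → C z ≡ r
    complete : ∀ {z} → C z ≡ r → z ∈ L

module _ {n} {C : Fin n → Fin n} where

  open Members

  Members-resp-↭ : ∀ {r L L′} → L ↭ L′ → Members C r L → Members C r L′
  Members-resp-↭ p M = record
    { unique   = Unique-resp-↭ p (unique M)
    ; sound    = sound M ∘ ∈-resp-↭ (↭-sym p)
    ; complete = ∈-resp-↭ p ∘ complete M
    }

  Members-union : ∀ {k r K L} → k ≢ r → Members C k K → Members C r L →
                  Members (relabel C k r) r (K ++ L)
  Members-union {k} {r} {K} {L} k≢r MK ML = record
    { unique   = Unique.++⁺ (unique MK) (unique ML)
                   (λ (z∈K , z∈L) → k≢r (trans (sym (sound MK z∈K)) (sound ML z∈L)))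
    ; sound    = λ z∈ → snd (∈-++⁻ K z∈)
    ; complete = cmp
    }
    where
    open Relabel C k r
    snd : ∀ {z} → _ → relabel C k r z ≡ r
    snd (inj₁ z∈K) = relabel-hit (sound MK z∈K)
    snd (inj₂ z∈L) = trans (relabel-miss (λ p → k≢r (trans (sym p) (sound ML z∈L)))) (sound ML z∈L)
    cmp : ∀ {z} → relabel C k r z ≡ r → z ∈ K ++ L
    cmp {z} p with relabel-cases z
    ... | inj₁ (q , _) = ∈-++⁺ˡ (complete MK q)
    ... | inj₂ (_ , q) = ∈-++⁺ʳ K (complete ML (trans (sym q) p))

  Members-relabel : ∀ {k r q L} → q ≢ k → q ≢ r → Members C q L → Members (relabel C k r) q L
  Members-relabel {k} {r} {q} q≢k q≢r M = record
    { unique   = unique M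
    ; sound    = λ z∈ → trans (relabel-miss (λ p → q≢k (trans (sym (sound M z∈)) p))) (sound M z∈)
    ; complete = cmp
    }
    where
    open Relabel C k r
    cmp : ∀ {z} → relabel C k r z ≡ q → z ∈ _
    cmp {z} p with relabel-cases z
    ... | inj₁ (_ , e) = contradiction (trans (sym p) e) q≢r
    ... | inj₂ (_ , e) = complete M (trans (sym e) p)

Path : ∀ {n} → (Fin n → Fin n) → Fin n → List (Fin n) → Fin n → Set
Path N x []       y = N x ≡ y
Path N x (z ∷ zs) y = N x ≡ z × Path N z zs y

Path-cong : ∀ {n} {N N′ : Fin n → Fin n} {x x′} zs {y} → N′ x′ ≡ N x →
            (∀ {z} → z ∈ zs → N′ z ≡ N z) → Path N x zs y → Path N′ x′ zs y
Path-cong []       p same q       = trans p q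
Path-cong (z ∷ zs) p same (q , r) = trans p q , Path-cong zs (same (here refl)) (same ∘ there) r

Path-++ : ∀ {n} {N : Fin n → Fin n} {x r} zs {ws y} → Path N x zs r → Path N r ws y →
          Path N x (zs ++ r ∷ ws) y
Path-++ []       p       q = p , q
Path-++ (z ∷ zs) (p , r) q = p , Path-++ zs r q

-- After visiting seen, the walk is at x; following N it visits todo and
-- then returns to the root r.
record Walk {n} (N C : Fin n → Fin n) (r x : Fin n) (todo seen : List (Fin n)) : Set where
  field
    path    : Path N x todo r
    members : Members C r (x ∷ todo ++ seen)

Circle : ∀ {n} → (Fin n → Fin n) → (Fin n → Fin n) → Fin n → Set
Circle N C r = ∃[ todo ] Walk N C r r todo []

module _ {n} {N C : Fin n → Fin n} where

  open Walk
  open Members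

  Walk-advance : ∀ {r x y todo seen} → Walk N C r x (y ∷ todo) seen → Walk N C r y todo (x ∷ seen)
  Walk-advance {x = x} {y} {todo} {seen} W = record
    { path    = proj₂ (path W)
    ; members = Members-resp-↭ (↭-sym (shift x (y ∷ todo) seen)) (members W)
    }

  -- After the exchange, `x` leads into the rest of the circle of `k`; that circle closes at `k`,
  -- which now leads to the former successor of `x`. The whole absorbed component thus lands in
  -- front of the walk, and `seen` is unaffected.
  splice : ∀ {r x todo seen k} → k ≢ r → Walk N C r x todo seen → Circle N C k →
           ∃[ todo′ ] Walk (exchange N x k) (relabel C k r) r x todo′ seen
  splice {r} {x} {todo} {seen} {k} k≢r W (ks , V) = ks ++ k ∷ todo , record
    { path    = Path-++ ks
        (Path-cong ks (exchange-left N x≢k)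
          (λ z∈ → exchange-other N x≢k (x∉ks z∈) (λ { refl → Unique-head (unique (members V)) (∈-++⁺ˡ z∈) }))
          (path V))
        (Path-cong todo (exchange-right N x≢k)
          (λ z∈ → exchange-other N x≢k (λ { refl → Unique-head (unique (members W)) (∈-++⁺ˡ z∈) }) (k∉todo z∈))
          (path W))
    ; members = Members-resp-↭ perm (Members-union k≢r (members V) (members W))
    }
    where
    Cx : C x ≡ r
    Cx = sound (members W) (here refl)
    Ck : C k ≡ k
    Ck = sound (members V) (here refl)
    x≢k : x ≢ k
    x≢k refl = k≢r (trans (sym Ck) Cx)
    x∉ks : ∀ {z} → z ∈ ks → z ≢ x
    x∉ks z∈ refl = k≢r (trans (sym (sound (members V) (there (∈-++⁺ˡ z∈)))) Cx)
    k∉todo : ∀ {z} → z ∈ todo → z ≢ k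
    k∉todo z∈ refl = k≢r (trans (sym Ck) (sound (members W) (there (∈-++⁺ˡ z∈))))
    perm : (k ∷ ks ++ []) ++ x ∷ todo ++ seen ↭ x ∷ (ks ++ k ∷ todo) ++ seen
    perm rewrite ++-identityʳ ks =
      ↭-trans (shift x (k ∷ ks) (todo ++ seen))
        (prep x (↭-trans (↭-sym (shift k ks (todo ++ seen)))
          (↭-reflexive (sym (++-assoc ks (k ∷ todo) seen)))))

  -- Only `x` and `k` change successors, and neither belongs to the class of `q`.
  Circle-stays : ∀ {r x k q} → x ≢ k → C x ≡ r → C k ≡ k → q ≢ k → q ≢ r → Circle N C q →
                 Circle (exchange N x k) (relabel C k r) q
  Circle-stays {r} {x} {k} {q} x≢k Cx Ck q≢k q≢r (todo , W) = todo , record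
    { path    = Path-cong todo (keep (here refl)) (keep ∘ there ∘ ∈-++⁺ˡ) (path W)
    ; members = Members-relabel q≢k q≢r (members W)
    }
    where
    x≢q : ∀ {z} → C z ≡ q → z ≢ x
    x≢q Cz refl = q≢r (trans (sym Cz) Cx)
    k≢q : ∀ {z} → C z ≡ q → z ≢ k
    k≢q Cz refl = q≢k (trans (sym Cz) Ck)
    keep : ∀ {z} → z ∈ q ∷ todo ++ [] → exchange N x k z ≡ N z
    keep z∈ = exchange-other N x≢k (x≢q (sound (members W) z∈)) (k≢q (sound (members W) z∈))

-- The program.

Reg : Set
Reg = Fin 18

zeroʳ oneʳ threeʳ orderʳ : Reg
zeroʳ  = # 0
oneʳ   = # 1
threeʳ = # 2
orderʳ = # 3

-- `uʳ`, `rʳ` and `tʳ` are scratch registers. `tickʳ` runs from 0 to `limitʳ` and `turnʳ` from 0 to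
-- 3; together they are the clock. `xʳ` is the vertex that the search is visiting and `pʳ` the
-- position in its adjacency list.
cursorʳ uʳ rʳ tʳ tailʳ frontʳ tickʳ turnʳ limitʳ quotʳ restʳ pʳ xʳ rootʳ : Reg
cursorʳ = # 4
uʳ      = # 5
rʳ      = # 6
tʳ      = # 7
tailʳ   = # 8
frontʳ  = # 9
tickʳ   = # 10
turnʳ   = # 11
limitʳ  = # 12
quotʳ   = # 13
restʳ   = # 14
pʳ      = # 15
xʳ      = # 16
rootʳ   = # 17

-- `labelᵇ` leads to the name of a component, with the default 0 for no label; `nextᵇ` holds the
-- successors in the circular lists; the two queues hold the two ends of each edge found.
labelᵇ nextᵇ queue₁ᵇ queue₂ᵇ : Fin 4
labelᵇ  = # 0
nextᵇ   = # 1
queue₁ᵇ = # 2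
queue₂ᵇ = # 3

prog : Program
prog = record
  { registers = 18
  ; blocks    = 4
  ; kinds     = lazyInit ∷ lazyInit ∷ lazyInit ∷ lazyInit ∷ []
  ; code      =
      order orderʳ                           -- 0: set-up
    ∷ reserve labelᵇ orderʳ
    ∷ reserve nextᵇ orderʳ
    ∷ reserve queue₁ᵇ orderʳ
    ∷ reserve queue₂ᵇ orderʳ
    ∷ const oneʳ 1
    ∷ const threeʳ 3
    ∷ first pʳ zeroʳ
    -- In a connected graph, vertex 0 has no neighbour only if it is the only vertex; then there is
    -- nothing to emit.
    ∷ jumpNil pʳ 78
    ∷ first pʳ cursorʳ                       -- 9: first phase
    ∷ target uʳ pʳ
    ∷ load rʳ labelᵇ cursorʳ
    ∷ jumpIf lt zeroʳ rʳ 25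
    ∷ load rʳ labelᵇ uʳ
    ∷ jumpIf lt zeroʳ rʳ 18
    ∷ move rʳ uʳ
    ∷ store labelᵇ uʳ uʳ
    ∷ store nextᵇ uʳ uʳ
    ∷ store labelᵇ cursorʳ rʳ                -- 18
    ∷ load tʳ nextᵇ rʳ
    ∷ store nextᵇ rʳ cursorʳ
    ∷ store nextᵇ cursorʳ tʳ
    ∷ store queue₁ᵇ tailʳ uʳ
    ∷ store queue₂ᵇ tailʳ cursorʳ
    ∷ arith add tailʳ tailʳ oneʳ
    ∷ degree uʳ cursorʳ                      -- 25: the sum of degrees, as quot * n + rest to fit into words
    ∷ arith sub tʳ orderʳ restʳ
    ∷ jumpIf lt uʳ tʳ 31
    ∷ arith sub restʳ uʳ tʳ
    ∷ arith add quotʳ quotʳ oneʳ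
    ∷ jump 32
    ∷ arith add restʳ restʳ uʳ               -- 31
    ∷ arith add cursorʳ cursorʳ oneʳ         -- 32
    ∷ jumpIf lt cursorʳ orderʳ 39
    -- One hop suffices here: up to the end of the first phase, labels are the names themselves.
    ∷ load rootʳ labelᵇ zeroʳ
    ∷ move xʳ rootʳ
    ∷ first pʳ xʳ
    ∷ move limitʳ quotʳ
    ∷ jump 39
    ∷ jumpIf lt tickʳ limitʳ 49              -- 39: pacing
    ∷ move tickʳ zeroʳ
    ∷ jumpIf lt turnʳ threeʳ 51
    ∷ move turnʳ zeroʳ
    ∷ load uʳ queue₁ᵇ frontʳ
    ∷ load tʳ queue₂ᵇ frontʳ
    ∷ arith add frontʳ frontʳ oneʳ
    ∷ emit uʳ tʳ
    ∷ jumpIf lt cursorʳ orderʳ 9             -- 47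
    ∷ jump 53
    ∷ arith add tickʳ tickʳ oneʳ             -- 49
    ∷ jump 47
    ∷ arith add turnʳ turnʳ oneʳ             -- 51
    ∷ jump 47
    ∷ target uʳ pʳ                           -- 53: second phase
    ∷ load rʳ labelᵇ uʳ
    ∷ load tʳ labelᵇ rʳ
    ∷ jumpIf eq tʳ rootʳ 65
    ∷ store queue₁ᵇ tailʳ xʳ
    ∷ store queue₂ᵇ tailʳ uʳ
    ∷ arith add tailʳ tailʳ oneʳ
    ∷ store labelᵇ rʳ rootʳ
    ∷ load tʳ nextᵇ xʳ
    ∷ load uʳ nextᵇ rʳ
    ∷ store nextᵇ xʳ uʳ
    ∷ store nextᵇ rʳ tʳ
    ∷ next pʳ pʳ                             -- 65
    ∷ jumpNil pʳ 68
    ∷ jump 39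
    ∷ load xʳ nextᵇ xʳ                       -- 68
    ∷ jumpIf eq xʳ rootʳ 72
    ∷ first pʳ xʳ
    ∷ jump 39
    ∷ jumpIf eq frontʳ tailʳ 78              -- 72: flush
    ∷ load uʳ queue₁ᵇ frontʳ
    ∷ load tʳ queue₂ᵇ frontʳ
    ∷ arith add frontʳ frontʳ oneʳ
    ∷ emit uʳ tʳ
    ∷ jump 72
    ∷ halt                                   -- 78
    ∷ []
  }

-- Machine arithmetic and single instructions.

<ᵇ-true : ∀ {m n} → m < n → (m <ᵇ n) ≡ true
<ᵇ-true {m} {n} m<n with m <ᵇ n | <⇒<ᵇ m<n
... | true | _ = refl

<ᵇ-false : ∀ {m n} → n ≤ m → (m <ᵇ n) ≡ false
<ᵇ-false {m} {n} n≤m with m <ᵇ n in p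
... | false = refl
... | true  = contradiction n≤m (<⇒≱ (<ᵇ⇒< m n (subst T (sym p) _)))

≡ᵇ-true : ∀ m → (m ≡ᵇ m) ≡ true
≡ᵇ-true zero    = refl
≡ᵇ-true (suc m) = ≡ᵇ-true m

≡ᵇ-false : ∀ {m n} → m ≢ n → (m ≡ᵇ n) ≡ false
≡ᵇ-false {zero}  {zero}  p = contradiction refl p
≡ᵇ-false {zero}  {suc n} p = refl
≡ᵇ-false {suc m} {zero}  p = refl
≡ᵇ-false {suc m} {suc n} p = ≡ᵇ-false (p ∘ cong suc)

asVertex-toℕ : ∀ {n} (v : Fin n) → asVertex (word (toℕ v)) ≡ just v
asVertex-toℕ {n} v with toℕ v <? n
... | yes p  = cong just (fromℕ<-toℕ v p)
... | no v≮n = contradiction (toℕ<n v) v≮n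

truncate-small : ∀ {w x} → x < 2 ^ w → truncate w x ≡ x
truncate-small {w} p = m<n⇒m%n≡m {{m^n≢0 2 w}} p

applyOp-add : ∀ {w x y} → x + y < 2 ^ w → applyOp w add x y ≡ just (x + y)
applyOp-add {w} p = cong just (truncate-small {w} p)

applyOp-sub : ∀ {w x y} → y ≤ x → x < 2 ^ w → applyOp w sub x y ≡ just (x ∸ y)
applyOp-sub {w} {x} {y} y≤x x< = cong just (begin
  truncate w (x + (2 ^ w ∸ y))      ≡⟨ cong (truncate w) shifted ⟩
  truncate w (x ∸ y + 2 ^ w)        ≡⟨ [m+n]%n≡m%n (x ∸ y) (2 ^ w) {{m^n≢0 2 w}} ⟩
  truncate w (x ∸ y)                ≡⟨ truncate-small {w} (≤-<-trans (m∸n≤m x y) x<) ⟩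
  x ∸ y                             ∎)
  where
  open ≡-Reasoning
  y≤ : y ≤ 2 ^ w
  y≤ = ≤-trans y≤x (<⇒≤ x<)
  shifted : x + (2 ^ w ∸ y) ≡ x ∸ y + 2 ^ w
  shifted = trans (sym (+-∸-assoc x y≤)) (+-∸-comm (2 ^ w) y≤x)

-- The part of a state that varies after the set-up; `at` adds the program counter, the constant
-- registers and the block sizes. Registers that always hold a number are stored as such, which
-- spares the runs any proof that they are words.
record Frame (n : ℕ) : Set where
  field
    cursor tail front tick turn limit quot rest : ℕ
    u r t p x root : Value n
    mem : Fin 4 → ℕ → Value n

open Frame public

at : ∀ {n} → Label → Frame n → State prog n
at {n} l F = mkState l
  (word 0 ∷ word 1 ∷ word 3 ∷ word n ∷ word (cursor F) ∷ u F ∷ r F ∷ t F ∷ word (tail F) ∷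
   word (front F) ∷ word (tick F) ∷ word (turn F) ∷ word (limit F) ∷ word (quot F) ∷ word (rest F) ∷
   p F ∷ x F ∷ root F ∷ [])
  (n ∷ n ∷ n ∷ n ∷ []) (mem F)

module Machine {n} {G : Graph n} (A : AdjacencyLists G) (w : ℕ) where

  open Run prog A w public using (exec; step; SilentSteps; _∷_; done; setCell; advance; goto)

  write : Fin 4 → ℕ → Value n → (Fin 4 → ℕ → Value n) → Fin 4 → ℕ → Value n
  write = setCell

  write-hit : ∀ i a {x} m → write i a x m i a ≡ x
  write-hit i a m rewrite ≡ᵇ-true (toℕ i) | ≡ᵇ-true a = refl

  write-miss : ∀ i {a c} x m → c ≢ a → write i a x m i c ≡ m i c
  write-miss i x m c≢a rewrite ≡ᵇ-true (toℕ i) | ≡ᵇ-false c≢a = refl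

  put : Reg → Value n → State prog n → State prog n
  put q y s = advance (record s { regs = regs s [ q ]≔ y })

  save : Fin 4 → ℕ → Reg → State prog n → State prog n
  save i v b s = advance (record s { cells = write i v (lookup (regs s) b) (cells s) })

  Fetch : State prog n → Instr 18 4 → Set
  Fetch s i = List.head (drop (pc s) (code prog)) ≡ just i

  by : ∀ s {i e} → Fetch s i → exec i s ≡ just e → step s ≡ just e
  by s f e rewrite f = e

  private variable
    s s′ : State prog n
    k    : ℕ

  -- The instruction lemmas take the rest of the run as last premise, so nesting them verifies
  -- straight-line code. For a state of the form `at l F` the premises about fetching and registers
  -- mostly hold by computation.
  load-step : ∀ {q i a v y} → Fetch s (load q i a) → lookup (regs s) a ≡ word v →
              v < lookup (sizes s) i → cells s i v ≡ y →
              SilentSteps k (put q y s) s′ →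
              SilentSteps (suc k) s s′
  load-step {s = s} {q = q} {i} {a} {v} {y} f ra v< m rest = by s f run ∷ rest
    where
    run : exec (load q i a) s ≡ just (silent (put q y s))
    run rewrite ra | <ᵇ-true v< | m = refl

  store-step : ∀ {i a b v} → Fetch s (store i a b) → lookup (regs s) a ≡ word v →
               v < lookup (sizes s) i →
               SilentSteps k (save i v b s) s′ →
               SilentSteps (suc k) s s′
  store-step {s = s} {i = i} {a} {b} {v} f ra v< rest = by s f run ∷ rest
    where
    run : exec (store i a b) s ≡ just (silent (save i v b s))
    run rewrite ra | <ᵇ-true v< = refl

  arith-step : ∀ {o q a b y z v} → Fetch s (arith o q a b) → lookup (regs s) a ≡ word y →
               lookup (regs s) b ≡ word z → applyOp w o y z ≡ just v →
               SilentSteps k (put q (word v) s) s′ →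
               SilentSteps (suc k) s s′
  arith-step {s = s} {o = o} {q} {a} {b} {v = v} f ra rb op rest = by s f run ∷ rest
    where
    run : exec (arith o q a b) s ≡ just (silent (put q (word v) s))
    run rewrite ra | rb | op = refl

  jumping : ∀ {c a b l y z} → Fetch s (jumpIf c a b l) → lookup (regs s) a ≡ word y →
            lookup (regs s) b ≡ word z → test c y z ≡ true →
            SilentSteps k (goto l s) s′ → SilentSteps (suc k) s s′
  jumping {s = s} {c = c} {a} {b} {l} f ra rb t rest = by s f run ∷ rest
    where
    run : exec (jumpIf c a b l) s ≡ just (silent (goto l s))
    run rewrite ra | rb | t = refl

  staying : ∀ {c a b l y z} → Fetch s (jumpIf c a b l) → lookup (regs s) a ≡ word y →
            lookup (regs s) b ≡ word z → test c y z ≡ false →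
            SilentSteps k (advance s) s′ → SilentSteps (suc k) s s′
  staying {s = s} {c = c} {a} {b} {l} f ra rb t rest = by s f run ∷ rest
    where
    run : exec (jumpIf c a b l) s ≡ just (silent (advance s))
    run rewrite ra | rb | t = refl

  first-step : ∀ {q a v} → Fetch s (first q a) → lookup (regs s) a ≡ word (toℕ v) →
               SilentSteps k (put q (ref (adj A v)) s) s′ →
               SilentSteps (suc k) s s′
  first-step {s = s} {q = q} {a} {v} f ra rest = by s f run ∷ rest
    where
    run : exec (first q a) s ≡ just (silent (put q (ref (adj A v)) s))
    run rewrite ra | asVertex-toℕ v = refl

  degree-step : ∀ {q a v} → Fetch s (degree q a) → lookup (regs s) a ≡ word (toℕ v) →
                SilentSteps k (put q (word (deg A v)) s) s′ →
                SilentSteps (suc k) s s′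
  degree-step {s = s} {q = q} {a} {v} f ra rest = by s f run ∷ rest
    where
    run : exec (degree q a) s ≡ just (silent (put q (word (deg A v)) s))
    run rewrite ra | asVertex-toℕ v = refl

  target-step : ∀ {q a y ys} → Fetch s (target q a) → lookup (regs s) a ≡ ref (y ∷ ys) →
                SilentSteps k (put q (word (toℕ y)) s) s′ →
                SilentSteps (suc k) s s′
  target-step {s = s} {q = q} {a} {y} f ra rest = by s f run ∷ rest
    where
    run : exec (target q a) s ≡ just (silent (put q (word (toℕ y)) s))
    run rewrite ra = refl

  emit-step : ∀ {a b y z} → Fetch s (emit a b) → lookup (regs s) a ≡ word (toℕ y) →
              lookup (regs s) b ≡ word (toℕ z) → step s ≡ just (emitting (y , z) (advance s))
  emit-step {s = s} {a = a} {b} {y} {z} f ra rb = by s f run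
    where
    run : exec (emit a b) s ≡ just (emitting (y , z) (advance s))
    run rewrite ra | rb | asVertex-toℕ y | asVertex-toℕ z = refl

  move-step : ∀ {q a} → Fetch s (move q a) → SilentSteps k (put q (lookup (regs s) a) s) s′ →
              SilentSteps (suc k) s s′
  move-step {s = s} f rest = by s f refl ∷ rest

  jump-step : ∀ {l} → Fetch s (jump l) → SilentSteps k (goto l s) s′ → SilentSteps (suc k) s s′
  jump-step {s = s} f rest = by s f refl ∷ rest

  next-step : ∀ {q a y ys} → Fetch s (next q a) → lookup (regs s) a ≡ ref (y ∷ ys) →
              SilentSteps k (put q (ref ys) s) s′ → SilentSteps (suc k) s s′
  next-step {s = s} {q = q} {a} {y} {ys} f ra rest = by s f run ∷ rest
    where
    run : exec (next q a) s ≡ just (silent (put q (ref ys) s))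
    run rewrite ra = refl

  nil-step : ∀ {a l} → Fetch s (jumpNil a l) → lookup (regs s) a ≡ ref [] →
             SilentSteps k (goto l s) s′ → SilentSteps (suc k) s s′
  nil-step {s = s} {a = a} {l} f ra rest = by s f run ∷ rest
    where
    run : exec (jumpNil a l) s ≡ just (silent (goto l s))
    run rewrite ra = refl

  cons-step : ∀ {a l y ys} → Fetch s (jumpNil a l) → lookup (regs s) a ≡ ref (y ∷ ys) →
              SilentSteps k (advance s) s′ → SilentSteps (suc k) s s′
  cons-step {s = s} {a = a} {l} f ra rest = by s f run ∷ rest
    where
    run : exec (jumpNil a l) s ≡ just (silent (advance s))
    run rewrite ra = refl

  reserved : Fin 4 → ℕ → State prog n → State prog n
  reserved i c s = advance (record s { sizes = sizes s [ i ]≔ c })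

  order-step : ∀ {q} → Fetch s (order q) → SilentSteps k (put q (word n) s) s′ → SilentSteps (suc k) s s′
  order-step {s = s} f rest = by s f refl ∷ rest

  const-step : ∀ {q c v} → Fetch s (const q c) → truncate w c ≡ v → SilentSteps k (put q (word v) s) s′ →
               SilentSteps (suc k) s s′
  const-step {s = s} f refl rest = by s f refl ∷ rest

  reserve-step : ∀ {i a c} → Fetch s (reserve i a) → lookup (regs s) a ≡ word c → lookup (sizes s) i ≡ 0 →
                 SilentSteps k (reserved i c s) s′ → SilentSteps (suc k) s s′
  reserve-step {s = s} {i = i} {a} {c} f ra free rest = by s f run ∷ rest
    where
    run : exec (reserve i a) s ≡ just (silent (reserved i c s))
    run rewrite ra | free = refl

-- Runs of the straight-line pieces of the program.

module Runs {n} {G : Graph n} (A : AdjacencyLists G) (w : ℕ) (n<2^w : n < 2 ^ w) where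

  open Machine A w public

  private variable
    v a b c d k ρ x₀ : Fin n
    as bs : List (Fin n)
    F     : Frame n

  increment : ∀ {y} → y < n → applyOp w add y 1 ≡ just (suc y)
  increment {y} y<n = subst (λ z → applyOp w add y 1 ≡ just z) (+-comm y 1)
    (applyOp-add {w} {y} {1} (subst (_< 2 ^ w) (+-comm 1 y) (≤-<-trans y<n n<2^w)))

  deg≤n : ∀ v → deg A v ≤ n
  deg≤n v = length-Unique≤ (unique A v)

  -- This and the next two memories list the writes in the order of the program, the latest
  -- outermost, so that the runs reach them definitionally.
  touchMem : Fin n → (Fin 4 → ℕ → Value n) → Fin 4 → ℕ → Value n
  touchMem a m = write nextᵇ (toℕ a) (word (toℕ a)) (write labelᵇ (toℕ a) (word (toℕ a)) m)

  linkMem : Fin n → Fin n → Fin n → Fin n → ℕ → (Fin 4 → ℕ → Value n) → Fin 4 → ℕ → Value n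
  linkMem v a k c l m =
    write queue₂ᵇ l (word (toℕ v)) (write queue₁ᵇ l (word (toℕ a))
    (write nextᵇ (toℕ v) (word (toℕ c)) (write nextᵇ (toℕ k) (word (toℕ v))
    (write labelᵇ (toℕ v) (word (toℕ k)) m))))

  absorbMem : Fin n → Fin n → Fin n → Fin n → Fin n → Fin n → ℕ →
              (Fin 4 → ℕ → Value n) → Fin 4 → ℕ → Value n
  absorbMem x₀ a k ρ c d l m =
    write nextᵇ (toℕ k) (word (toℕ c)) (write nextᵇ (toℕ x₀) (word (toℕ d))
    (write labelᵇ (toℕ k) (word (toℕ ρ))
    (write queue₂ᵇ l (word (toℕ a)) (write queue₁ᵇ l (word (toℕ x₀)) m))))

  skip-run : adj A v ≡ a ∷ as → mem F labelᵇ (toℕ v) ≡ word (toℕ k) → 0 < toℕ k →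
             SilentSteps 4 (at 9 record F { cursor = toℕ v })
               (at 25 record F { cursor = toℕ v; p = ref (adj A v); u = word (toℕ a); r = word (toℕ k) })
  skip-run {v = v} adj≡ m 0<k =
    first-step refl refl (
    target-step refl (cong ref adj≡) (
    load-step refl refl (toℕ<n v) m (
    jumping refl refl refl (<ᵇ-true 0<k) done)))

  find-run : adj A v ≡ a ∷ as → mem F labelᵇ (toℕ v) ≡ word 0 →
             mem F labelᵇ (toℕ a) ≡ word (toℕ k) → 0 < toℕ k →
             SilentSteps 6 (at 9 record F { cursor = toℕ v })
               (at 18 record F { cursor = toℕ v; p = ref (adj A v); u = word (toℕ a); r = word (toℕ k) })
  find-run {v = v} {a = a} adj≡ m m′ 0<k =
    first-step refl refl (
    target-step refl (cong ref adj≡) (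
    load-step refl refl (toℕ<n v) m (
    staying refl refl refl refl (
    load-step refl refl (toℕ<n a) m′ (
    jumping refl refl refl (<ᵇ-true 0<k) done)))))

  touch-run : adj A v ≡ a ∷ as → mem F labelᵇ (toℕ v) ≡ word 0 → mem F labelᵇ (toℕ a) ≡ word 0 →
              SilentSteps 9 (at 9 record F { cursor = toℕ v })
                (at 18 record F { cursor = toℕ v; p = ref (adj A v); u = word (toℕ a)
                                ; r = word (toℕ a); mem = touchMem a (mem F) })
  touch-run {v = v} {a = a} adj≡ m m′ =
    first-step refl refl (
    target-step refl (cong ref adj≡) (
    load-step refl refl (toℕ<n v) m (
    staying refl refl refl refl (
    load-step refl refl (toℕ<n a) m′ (
    staying refl refl refl refl (
    move-step refl (
    store-step refl refl (toℕ<n a) (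
    store-step refl refl (toℕ<n a) done))))))))

  link-run : mem F nextᵇ (toℕ k) ≡ word (toℕ c) → tail F < n →
             SilentSteps 7 (at 18 record F { cursor = toℕ v; u = word (toℕ a); r = word (toℕ k) })
               (at 25 record F { cursor = toℕ v; u = word (toℕ a); r = word (toℕ k); t = word (toℕ c)
                               ; tail = suc (tail F); mem = linkMem v a k c (tail F) (mem F) })
  link-run {k = k} {v = v} m l<n =
    store-step refl refl (toℕ<n v) (
    load-step refl refl (toℕ<n k) m (
    store-step refl refl (toℕ<n k) (
    store-step refl refl (toℕ<n v) (
    store-step refl refl l<n (
    store-step refl refl l<n (
    arith-step refl refl refl (increment l<n) done))))))

  -- Comparing the degree with `n ∸ rest` avoids forming `rest + deg` when it may exceed `n`; only
  -- `n < 2 ^ w` is known.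
  small-degree-run : rest F < n → deg A v < n ∸ rest F →
    SilentSteps 4 (at 25 record F { cursor = toℕ v })
      (at 32 record F { cursor = toℕ v; u = word (deg A v); t = word (n ∸ rest F)
                      ; rest = rest F + deg A v })
  small-degree-run {F} {v} rest<n d< =
    degree-step refl refl (
    arith-step refl refl refl (applyOp-sub {w} {n} (<⇒≤ rest<n) n<2^w) (
    jumping refl refl refl (<ᵇ-true d<) (
    arith-step refl refl refl (applyOp-add {w} {rest F} {deg A v} sum<) done)))
    where
    sum< : rest F + deg A v < 2 ^ w
    sum< = <-trans (<-≤-trans (+-monoʳ-< (rest F) d<) (≤-reflexive (m+[n∸m]≡n (<⇒≤ rest<n)))) n<2^w

  large-degree-run : rest F < n → n ∸ rest F ≤ deg A v → quot F < n →
    SilentSteps 6 (at 25 record F { cursor = toℕ v })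
      (at 32 record F { cursor = toℕ v; u = word (deg A v); t = word (n ∸ rest F)
                      ; rest = deg A v ∸ (n ∸ rest F); quot = suc (quot F) })
  large-degree-run {v = v} rest<n d≥ quot<n =
    degree-step refl refl (
    arith-step refl refl refl (applyOp-sub {w} {n} (<⇒≤ rest<n) n<2^w) (
    staying refl refl refl (<ᵇ-false d≥) (
    arith-step refl refl refl (applyOp-sub {w} {deg A v} d≥ (≤-<-trans (deg≤n v) n<2^w)) (
    arith-step refl refl refl (increment quot<n) (
    jump-step refl done)))))

  again-run : suc (toℕ v) < n →
              SilentSteps 2 (at 32 record F { cursor = toℕ v }) (at 39 record F { cursor = suc (toℕ v) })
  again-run {v = v} sv<n =
    arith-step refl refl refl (increment (toℕ<n v)) (
    jumping refl refl refl (<ᵇ-true sv<n) done)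

  setup-run : n ≤ suc (toℕ v) → 0 < n → mem F labelᵇ 0 ≡ word (toℕ ρ) →
              SilentSteps 7 (at 32 record F { cursor = toℕ v })
                (at 39 record F { cursor = suc (toℕ v); root = word (toℕ ρ); x = word (toℕ ρ)
                                ; p = ref (adj A ρ); limit = quot F })
  setup-run {v = v} n≤sv 0<n m =
    arith-step refl refl refl (increment (toℕ<n v)) (
    staying refl refl refl (<ᵇ-false n≤sv) (
    load-step refl refl 0<n m (
    move-step refl (
    first-step refl refl (
    move-step refl (
    jump-step refl done))))))

  tick-run : tick F < limit F → tick F < n → SilentSteps 3 (at 39 F) (at 47 record F { tick = suc (tick F) })
  tick-run t<l t<n =
    jumping refl refl refl (<ᵇ-true t<l) (
    arith-step refl refl refl (increment t<n) (
    jump-step refl done))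

  turn-run : limit F ≤ tick F → turn F < 3 → 3 < 2 ^ w →
             SilentSteps 5 (at 39 F) (at 47 record F { tick = 0; turn = suc (turn F) })
  turn-run {F = F} l≤t t<3 3<2^w =
    staying refl refl refl (<ᵇ-false l≤t) (
    move-step refl (
    jumping refl refl refl (<ᵇ-true t<3) (
    arith-step refl refl refl
      (subst (λ z → applyOp w add (turn F) 1 ≡ just z) (+-comm (turn F) 1)
        (applyOp-add {w} {turn F} {1} (subst (_< 2 ^ w) (+-comm 1 (turn F)) (≤-<-trans t<3 3<2^w)))) (
    jump-step refl done))))

  fetch-run : limit F ≤ tick F → 3 ≤ turn F → front F < n →
              mem F queue₁ᵇ (front F) ≡ word (toℕ a) → mem F queue₂ᵇ (front F) ≡ word (toℕ b) →
              SilentSteps 7 (at 39 F)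
                (at 46 record F { tick = 0; turn = 0; u = word (toℕ a); t = word (toℕ b); front = suc (front F) })
  fetch-run l≤t 3≤t f<n m₁ m₂ =
    staying refl refl refl (<ᵇ-false l≤t) (
    move-step refl (
    staying refl refl refl (<ᵇ-false 3≤t) (
    move-step refl (
    load-step refl refl f<n m₁ (
    load-step refl refl f<n m₂ (
    arith-step refl refl refl (increment f<n) done))))))

  emit-46 : step (at 46 record F { u = word (toℕ a); t = word (toℕ b) })
            ≡ just (emitting (a , b) (at 47 record F { u = word (toℕ a); t = word (toℕ b) }))
  emit-46 {F = F} {a = a} {b = b} = emit-step {s = at 46 record F { u = word (toℕ a); t = word (toℕ b) }} refl refl refl

  phase₁-run : cursor F < n → SilentSteps 1 (at 47 F) (at 9 F)
  phase₁-run c<n = jumping refl refl refl (<ᵇ-true c<n) done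

  phase₂-run : n ≤ cursor F → SilentSteps 2 (at 47 F) (at 53 F)
  phase₂-run n≤c = staying refl refl refl (<ᵇ-false n≤c) (jump-step refl done)

  old-run : mem F labelᵇ (toℕ a) ≡ word (toℕ k) → mem F labelᵇ (toℕ k) ≡ word (toℕ ρ) →
            SilentSteps 4 (at 53 record F { p = ref (a ∷ as); root = word (toℕ ρ) })
              (at 65 record F { p = ref (a ∷ as); root = word (toℕ ρ)
                              ; u = word (toℕ a); r = word (toℕ k); t = word (toℕ ρ) })
  old-run {a = a} {k = k} {ρ = ρ} m m′ =
    target-step refl refl (
    load-step refl refl (toℕ<n a) m (
    load-step refl refl (toℕ<n k) m′ (
    jumping refl refl refl (≡ᵇ-true (toℕ ρ)) done)))

  absorb-run : mem F labelᵇ (toℕ a) ≡ word (toℕ k) → mem F labelᵇ (toℕ k) ≡ word (toℕ k) → k ≢ ρ →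
    tail F < n → mem F nextᵇ (toℕ x₀) ≡ word (toℕ c) → mem F nextᵇ (toℕ k) ≡ word (toℕ d) →
    SilentSteps 12 (at 53 record F { p = ref (a ∷ as); x = word (toℕ x₀); root = word (toℕ ρ) })
      (at 65 record F { p = ref (a ∷ as); x = word (toℕ x₀); root = word (toℕ ρ)
                      ; u = word (toℕ d); r = word (toℕ k); t = word (toℕ c)
                      ; tail = suc (tail F); mem = absorbMem x₀ a k ρ c d (tail F) (mem F) })
  absorb-run {a = a} {k = k} {x₀ = x₀} m m′ k≢ρ l<n mx mk =
    target-step refl refl (
    load-step refl refl (toℕ<n a) m (
    load-step refl refl (toℕ<n k) m′ (
    staying refl refl refl (≡ᵇ-false (k≢ρ ∘ toℕ-injective)) (
    store-step refl refl l<n (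
    store-step refl refl l<n (
    arith-step refl refl refl (increment l<n) (
    store-step refl refl (toℕ<n k) (
    load-step refl refl (toℕ<n x₀) mx (
    load-step refl refl (toℕ<n k) mk (
    store-step refl refl (toℕ<n x₀) (
    store-step refl refl (toℕ<n k) done)))))))))))

  next-run : SilentSteps 3 (at 65 record F { p = ref (a ∷ b ∷ bs) }) (at 39 record F { p = ref (b ∷ bs) })
  next-run = next-step refl refl (cons-step refl refl (jump-step refl done))

  last-run : SilentSteps 2 (at 65 record F { p = ref (a ∷ []) }) (at 68 record F { p = ref [] })
  last-run = next-step refl refl (nil-step refl refl done)

  advance-run : mem F nextᵇ (toℕ x₀) ≡ word (toℕ k) → k ≢ ρ →
                SilentSteps 4 (at 68 record F { x = word (toℕ x₀); root = word (toℕ ρ) })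
                  (at 39 record F { x = word (toℕ k); root = word (toℕ ρ); p = ref (adj A k) })
  advance-run {x₀ = x₀} m k≢ρ =
    load-step refl refl (toℕ<n x₀) m (
    staying refl refl refl (≡ᵇ-false (k≢ρ ∘ toℕ-injective)) (
    first-step refl refl (
    jump-step refl done)))

  stop-run : mem F nextᵇ (toℕ x₀) ≡ word (toℕ ρ) →
             SilentSteps 2 (at 68 record F { x = word (toℕ x₀); root = word (toℕ ρ) })
               (at 72 record F { x = word (toℕ ρ); root = word (toℕ ρ) })
  stop-run {x₀ = x₀} {ρ = ρ} m =
    load-step refl refl (toℕ<n x₀) m (
    jumping refl refl refl (≡ᵇ-true (toℕ ρ)) done)

  halt-run : front F ≡ tail F → SilentSteps 1 (at 72 F) (at 78 F)
  halt-run {F} f≡l = jumping refl refl refl (trans (cong (λ z → test eq z (tail F)) f≡l) (≡ᵇ-true (tail F))) done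

  flush-run : front F ≢ tail F → front F < n →
              mem F queue₁ᵇ (front F) ≡ word (toℕ a) → mem F queue₂ᵇ (front F) ≡ word (toℕ b) →
              SilentSteps 4 (at 72 F)
                (at 76 record F { u = word (toℕ a); t = word (toℕ b); front = suc (front F) })
  flush-run f≢l f<n m₁ m₂ =
    staying refl refl refl (≡ᵇ-false f≢l) (
    load-step refl refl f<n m₁ (
    load-step refl refl f<n m₂ (
    arith-step refl refl refl (increment f<n) done)))

  emit-76 : step (at 76 record F { u = word (toℕ a); t = word (toℕ b) })
            ≡ just (emitting (a , b) (at 77 record F { u = word (toℕ a); t = word (toℕ b) }))
  emit-76 {F = F} {a = a} {b = b} = emit-step {s = at 76 record F { u = word (toℕ a); t = word (toℕ b) }} refl refl refl

  -- The two constants are parameters because for a single vertex the word size may be 1, and 3 is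
  -- then truncated.
  booted : ℕ → ℕ → (Fin 4 → ℕ → Value n) → State prog n
  booted one three m = mkState 7
    (word 0 ∷ word one ∷ word three ∷ word n ∷ replicate 14 (word 0)) (n ∷ n ∷ n ∷ n ∷ []) m

  boot-run : ∀ {garbage one three} → truncate w 1 ≡ one → truncate w 3 ≡ three →
             SilentSteps 7 (initial prog A w garbage)
               (booted one three (cells (initial prog A w garbage)))
  boot-run p q =
    order-step refl (
    reserve-step refl refl refl (
    reserve-step refl refl refl (
    reserve-step refl refl refl (
    reserve-step refl refl refl (
    const-step refl p (
    const-step refl q done))))))

-- The queue of pending edges and the pacing of emissions.

word-injective : ∀ {n x y} → word {n} x ≡ word y → x ≡ y
word-injective refl = refl

module _ {n : ℕ} where

  Queued : (Fin 4 → ℕ → Value n) → ℕ → List (Fin n × Fin n) → Set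
  Queued m k []             = ⊤
  Queued m k ((a , b) ∷ es) = m queue₁ᵇ k ≡ word (toℕ a) × m queue₂ᵇ k ≡ word (toℕ b) × Queued m (suc k) es

  Queued-cong : ∀ {m m′} k es → (∀ i → i < k + length es → m′ queue₁ᵇ i ≡ m queue₁ᵇ i) →
                (∀ i → i < k + length es → m′ queue₂ᵇ i ≡ m queue₂ᵇ i) → Queued m k es → Queued m′ k es
  Queued-cong k []       same₁ same₂ _ = tt
  Queued-cong k (e ∷ es) same₁ same₂ (q₁ , q₂ , q) =
    trans (same₁ k k<) q₁ , trans (same₂ k k<) q₂ ,
    Queued-cong (suc k) es (λ i i< → same₁ i (subst (i <_) shifted i<)) (λ i i< → same₂ i (subst (i <_) shifted i<)) q
    where
    shifted : suc k + length es ≡ k + suc (length es)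
    shifted = sym (+-suc k (length es))
    k< : k < k + suc (length es)
    k< = m<m+n k (s≤s z≤n)

  Queued-∷ʳ : ∀ {m} k es {a b} → Queued m k es → m queue₁ᵇ (k + length es) ≡ word (toℕ a) →
              m queue₂ᵇ (k + length es) ≡ word (toℕ b) → Queued m k (es ∷ʳ (a , b))
  Queued-∷ʳ {m} k [] {a} {b} _ m₁ m₂ =
    subst (λ i → m queue₁ᵇ i ≡ word (toℕ a)) (+-identityʳ k) m₁ ,
    subst (λ i → m queue₂ᵇ i ≡ word (toℕ b)) (+-identityʳ k) m₂ , tt
  Queued-∷ʳ {m} k (e ∷ es) {a} {b} (q₁ , q₂ , q) m₁ m₂ = q₁ , q₂ ,
    Queued-∷ʳ (suc k) es q (subst (λ i → m queue₁ᵇ i ≡ word (toℕ a)) (+-suc k (length es)) m₁)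
      (subst (λ i → m queue₂ᵇ i ≡ word (toℕ b)) (+-suc k (length es)) m₂)

record Pending {n} (F : Frame n) (sent pend : List (Fin n × Fin n)) : Set where
  field
    front≡ : front F ≡ length sent
    tail≡  : tail F ≡ front F + length pend
    queued : Queued (mem F) (front F) pend

module Completion {n} {G : Graph n} (A : AdjacencyLists G) (w : ℕ) (n<2^w : n < 2 ^ w)
  (D : ℚᵘ) (top : ℕ) (within : ∀ {k} → k ≤ top → (+ k ℚ./ 1) ℚ.≤ D) where

  open Runs A w n<2^w public
  open Run.Enumerates

  infixr 5 _▷_

  _▷_ : ∀ {j k s s′ s″} → SilentSteps j s s′ → SilentSteps k s′ s″ → SilentSteps (j + k) s s″
  done     ▷ r = r
  (q ∷ qs) ▷ r = q ∷ (qs ▷ r)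

  -- Like Enumerates, but with the separate delay bound B for the first edge.
  data Timed (B : ℕ) (s : State prog n) : List (Fin n × Fin n) → State prog n → Set where
    stops : ∀ {k f} → SilentSteps k s f → step f ≡ just halted → Timed B s [] f
    sends : ∀ {k s′ s″ e es f} → SilentSteps k s s′ → step s′ ≡ just (emitting e s″) → suc k ≤ B →
            Enumerates prog A w D s″ es f → Timed B s (e ∷ es) f

  Timed⇒Enumerates : ∀ {B s es f} → B ≤ top → Timed B s es f → Enumerates prog A w D s es f
  Timed⇒Enumerates B≤ (stops r h)     = halts r h
  Timed⇒Enumerates B≤ (sends r e k e′) = emits r e (within (≤-trans k B≤)) e′

  SpanningForest : List (Fin n × Fin n) → Set
  SpanningForest es = ∃[ C ] (Forest G es C × (∀ u v → C u ≡ C v))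

  -- From s on, the program completes the list sent of emitted edges to a
  -- spanning tree, emitting the next edge within B steps.
  Completes : ℕ → State prog n → List (Fin n × Fin n) → Set
  Completes B s sent = ∃[ es ] ∃[ f ]
    (Timed B s es f × SpanningForest (sent ++ es) × sizes f ≡ n ∷ n ∷ n ∷ n ∷ [])

  after : ∀ {B B′ k s s′ sent} → k + B ≤ B′ → SilentSteps k s s′ → Completes B s′ sent → Completes B′ s sent
  after k≤ r (_ , f , stops r′ h , S) = [] , f , stops (r ▷ r′) h , S
  after {k = k} k≤ r (_ , f , sends {k = j} r′ e j< E , S) =
    _ , f , sends (r ▷ r′) e (≤-trans (≤-reflexive (sym (+-suc k j))) (≤-trans (+-monoʳ-≤ k j<) k≤)) E , S

  emitted : ∀ {B k s s′ s″ e sent} → suc k ≤ B → SilentSteps k s s′ → step s′ ≡ just (emitting e s″) →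
            Completes top s″ (sent ∷ʳ e) → Completes B s sent
  emitted {e = e} {sent} k< r em (es , f , T , F , S) =
    e ∷ es , f , sends r em k< (Timed⇒Enumerates ≤-refl T) ,
    subst SpanningForest (++-assoc sent (e ∷ []) es) F , S

  module _ {F : Frame n} {sent pend : List (Fin n × Fin n)} where

    length-found : Pending F sent pend → length (sent ++ pend) ≡ tail F
    length-found P = trans (length-++ sent) (trans (cong (_+ length pend) (sym front≡)) (sym tail≡))
      where open Pending P

    Pending-pop : ∀ {e pend′ F′} → Pending F sent pend → pend ≡ e ∷ pend′ → front F′ ≡ suc (front F) →
                  tail F′ ≡ tail F → mem F′ ≡ mem F → Pending F′ (sent ∷ʳ e) pend′
    Pending-pop {e} {pend′} {F′} P refl f≡ l≡ m≡ = record
      { front≡ = trans f≡ (trans (cong suc front≡) (trans (+-comm 1 _) (sym (length-++ sent))))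
      ; tail≡  = trans l≡ (trans tail≡ (trans (+-suc (front F) (length pend′)) (cong (_+ length pend′) (sym f≡))))
      ; queued = subst₂ (λ m k → Queued m k pend′) (sym m≡) (sym f≡) (proj₂ (proj₂ queued))
      }
      where open Pending P

  flush : ∀ {F sent} pend {C} → Pending F sent pend → Forest G (sent ++ pend) C → (∀ u v → C u ≡ C v) →
          Fin n → 6 ≤ top → Completes 5 (at 72 F) sent
  flush {F} {sent} [] P Fo one o _ =
    [] , at 78 F , stops (halt-run (sym (trans tail≡ (+-identityʳ (front F))))) refl , (_ , Fo , one) , refl
    where open Pending P
  flush {F} {sent} ((a , b) ∷ pend) P Fo one o 6≤ =
    emitted ≤-refl (flush-run f≢l f<n (proj₁ queued) (proj₁ (proj₂ queued))) (emit-76 {F = record F { front = suc (front F) }})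
      (after 6≤ (jump-step refl done)
        (flush pend (Pending-pop P refl refl refl refl)
          (subst (λ es → Forest G es _) (sym (++-assoc sent ((a , b) ∷ []) pend)) Fo) one o 6≤))
    where
    open Pending P
    f<l : front F < tail F
    f<l = subst (front F <_) (sym tail≡) (m<m+n (front F) (s≤s z≤n))
    f≢l : front F ≢ tail F
    f≢l = <⇒≢ f<l
    f<n : front F < n
    f<n = <-trans f<l (subst (_< n) (length-found P) (length-Forest< Fo (Forest.idem Fo o)))

  -- One tick of the clock, which runs for 4 * (limit + 1) ticks between two emissions.
  pace : ∀ {B F sent pend} → Pending F sent pend → tick F ≤ limit F → turn F ≤ 3 → limit F ≤ n → 3 < 2 ^ w →
    length (sent ++ pend) < n → (turn F ≡ 3 → tick F ≡ limit F → front F < length (sent ++ pend)) →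
    (∀ t s → t ≤ limit F → s ≤ 3 → s * suc (limit F) + t ≡ suc (turn F * suc (limit F) + tick F) →
       Completes B (at 47 record F { tick = t; turn = s }) sent) →
    (∀ a b pend′ → pend ≡ (a , b) ∷ pend′ → turn F ≡ 3 → tick F ≡ limit F →
       Completes top (at 47 record F { tick = 0; turn = 0; u = word (toℕ a); t = word (toℕ b); front = suc (front F) })
         (sent ∷ʳ (a , b))) →
    Completes (8 + B) (at 39 F) sent
  pace {B} {F} {sent} {pend} P t≤ s≤ l≤n 3< found< nonempty quiet loud with m≤n⇒m<n∨m≡n t≤ | m≤n⇒m<n∨m≡n s≤
  ... | inj₁ t< | _ = after (+-monoˡ-≤ B {3} {8} (m≤m+n 3 5)) (tick-run t< (<-≤-trans t< l≤n))
    (quiet (suc (tick F)) (turn F) t< s≤ (+-suc (turn F * suc (limit F)) (tick F)))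
  ... | inj₂ t≡ | inj₁ s< = after (+-monoˡ-≤ B {5} {8} (m≤m+n 5 3)) (turn-run (≤-reflexive (sym t≡)) s< 3<)
    (quiet 0 (suc (turn F)) z≤n s< carry)
    where
    -- The clock reads `turn * suc limit + tick`, a number in mixed radix; a full `tick` carries
    -- into `turn`.
    carry : suc (turn F) * suc (limit F) + 0 ≡ suc (turn F * suc (limit F) + tick F)
    carry rewrite t≡ = trans (+-identityʳ _) (cong suc (+-comm (limit F) _))
  ... | inj₂ t≡ | inj₂ s≡ = send pend refl P
    where
    send : ∀ pend′ → pend′ ≡ pend → Pending F sent pend′ → Completes (8 + B) (at 39 F) sent
    -- With nothing pending, the number of edges found is `tail`, which equals `front`.
    send [] refl P = contradiction (nonempty s≡ t≡)
      (≤⇒≯ (≤-reflexive (trans (length-found P) (trans tail≡ (+-identityʳ (front F))))))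
      where open Pending P
    send ((a , b) ∷ pend′) refl P = emitted (m≤m+n 8 B)
      (fetch-run (≤-reflexive (sym t≡)) (≤-reflexive (sym s≡)) (<-trans (nonempty s≡ t≡) found<)
        (proj₁ queued) (proj₁ (proj₂ queued)))
      (emit-46 {F = record F { tick = 0; turn = 0; front = suc (front F) }}) (loud a b pend′ refl s≡ t≡)
      where open Pending P

  Pending-push : ∀ {F F′ : Frame n} {sent pend a b} → Pending F sent pend → front F′ ≡ front F → tail F′ ≡ suc (tail F) →
                 (∀ i → i < tail F → mem F′ queue₁ᵇ i ≡ mem F queue₁ᵇ i) →
                 (∀ i → i < tail F → mem F′ queue₂ᵇ i ≡ mem F queue₂ᵇ i) →
                 mem F′ queue₁ᵇ (tail F) ≡ word (toℕ a) → mem F′ queue₂ᵇ (tail F) ≡ word (toℕ b) →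
                 Pending F′ sent (pend ∷ʳ (a , b))
  Pending-push {F} {F′} {sent} {pend} {a} {b} P f≡ l≡ same₁ same₂ m₁ m₂ = record
    { front≡ = trans f≡ front≡
    ; tail≡  = trans l≡ (trans (cong suc tail≡) (trans (sym (+-suc (front F) (length pend)))
                 (cong₂ _+_ (sym f≡) (trans (+-comm 1 _) (sym (length-++ pend))))))
    ; queued = subst (λ k → Queued (mem F′) k (pend ∷ʳ (a , b))) (sym f≡)
                 (Queued-∷ʳ (front F) pend
                   (Queued-cong (front F) pend (λ i i< → same₁ i (subst (i <_) (sym tail≡) i<))
                     (λ i i< → same₂ i (subst (i <_) (sym tail≡) i<)) queued)
                   (subst (λ k → mem F′ queue₁ᵇ k ≡ word (toℕ a)) tail≡ m₁)
                   (subst (λ k → mem F′ queue₂ᵇ k ≡ word (toℕ b)) tail≡ m₂))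
    }
    where open Pending P

  -- The invariant of the first phase.

  -- For `C` and `N` an unlabelled vertex is already a component with a circle of length one,
  -- although memory holds only the default label. `alone` lets it join another component by
  -- changing its own label only.
  record Fresh (m : Fin 4 → ℕ → Value n) (C N : Fin n → Fin n) (z : Fin n) : Set where
    field
      unlabelled : m labelᵇ (toℕ z) ≡ word 0
      own        : C z ≡ z
      loop       : N z ≡ z
      alone      : ∀ {y} → C y ≡ z → y ≡ z

  -- `positive` keeps a genuine label apart from the default 0. `T` collects the labelled vertices;
  -- its length is later compared with the number of edges.
  record Touched (m : Fin 4 → ℕ → Value n) (C N : Fin n → Fin n) (T : List (Fin n)) (z : Fin n) : Set where
    field
      label    : m labelᵇ (toℕ z) ≡ word (toℕ (C z))
      succ     : m nextᵇ (toℕ z) ≡ word (toℕ (N z))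
      positive : 0 < toℕ (C z)
      counted  : z ∈ T

  ¬Fresh×Touched : ∀ {m C N T z} → Fresh m C N z → ¬ Touched m C N T z
  ¬Fresh×Touched f t = <⇒≢ (Touched.positive t) (word-injective (trans (sym (Fresh.unlabelled f)) (Touched.label t)))

  record Labelled (m : Fin 4 → ℕ → Value n) (es : List (Fin n × Fin n))
                  (C N : Fin n → Fin n) (T : List (Fin n)) : Set where
    field
      forest  : Forest G es C
      circles : ∀ {q} → C q ≡ q → Circle N C q
      status  : ∀ z → Fresh m C N z ⊎ Touched m C N T z

  module _ {m es C N T} (I : Labelled m es C N T) where

    open Labelled I

    -- `C` and `N` stay as they are: memory catches up with the one-vertex component that they
    -- describe.
    touch : ∀ {a} → Fresh m C N a → 0 < toℕ a →
            Labelled (touchMem a m) es C N (a ∷ T) × Touched (touchMem a m) C N (a ∷ T) a ×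
            (∀ {z} → z ≢ a → Fresh m C N z → Fresh (touchMem a m) C N z) ×
            (∀ {z} → Touched m C N T z → Touched (touchMem a m) C N (a ∷ T) z)
    touch {a} fa 0<a = record { forest = forest ; circles = circles ; status = status′ } , here-touched , fresh , touched
      where
      open Fresh
      open Touched
      here-touched : Touched (touchMem a m) C N (a ∷ T) a
      here-touched = record
        { label    = trans (write-hit labelᵇ (toℕ a) m) (cong (word ∘ toℕ) (sym (own fa)))
        ; succ     = trans (write-hit nextᵇ (toℕ a) (write labelᵇ (toℕ a) (word (toℕ a)) m)) (cong (word ∘ toℕ) (sym (loop fa)))
        ; positive = subst (λ z → 0 < toℕ z) (sym (own fa)) 0<a
        ; counted  = here refl
        }
      fresh : ∀ {z} → z ≢ a → Fresh m C N z → Fresh (touchMem a m) C N z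
      fresh z≢a f = record
        { unlabelled = trans (write-miss labelᵇ (word (toℕ a)) m (z≢a ∘ toℕ-injective)) (unlabelled f)
        ; own = own f ; loop = loop f ; alone = alone f }
      touched : ∀ {z} → Touched m C N T z → Touched (touchMem a m) C N (a ∷ T) z
      touched {z} t = record
        { label    = trans (write-miss labelᵇ (word (toℕ a)) m z≢a) (label t)
        ; succ     = trans (write-miss nextᵇ (word (toℕ a)) (write labelᵇ (toℕ a) (word (toℕ a)) m) z≢a) (succ t)
        ; positive = positive t
        ; counted  = there (counted t) }
        where
        z≢a : toℕ z ≢ toℕ a
        z≢a p = ¬Fresh×Touched fa (subst (Touched m C N T) (toℕ-injective p) t)
      status′ : ∀ z → Fresh (touchMem a m) C N z ⊎ Touched (touchMem a m) C N (a ∷ T) z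
      status′ z with z ≟ a | status z
      ... | yes refl | _       = inj₂ here-touched
      ... | no z≢a   | inj₁ f  = inj₁ (fresh z≢a f)
      ... | no _     | inj₂ t  = inj₂ (touched t)

    -- A fresh name would be alone in its class, hence be `a` itself.
    name-touched : ∀ {a} → Touched m C N T a → Touched m C N T (C a)
    name-touched {a} ta with status (C a)
    ... | inj₂ t = t
    ... | inj₁ f = subst (Touched m C N T) (Fresh.alone f refl) ta

    -- As `v` is a whole class, one label write renames that class, and labels remain direct names.
    -- In the circle, `v` comes right after the name `C a`.
    link : ∀ {v a l} → Edge G a v → Fresh m C N v → Touched m C N T a →
           let m′ = linkMem v a (C a) (N (C a)) l m
               C′ = relabel C v (C a)
               N′ = exchange N (C a) v in
           Labelled m′ (es ∷ʳ (a , v)) C′ N′ (v ∷ T) × Touched m′ C′ N′ (v ∷ T) v ×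
           (∀ {z} → Touched m C N T z → Touched m′ C′ N′ (v ∷ T) z)
    link {v} {a} {l} av fv ta = record
      { forest  = subst (λ z → Forest G (es ∷ʳ (a , v)) (relabel C z k)) (own fv) (Forest-∷ʳ forest av (k≢v ∘ (λ p → trans p (own fv))))
      ; circles = circles′
      ; status  = status′
      } , v-touched , touched
      where
      open Fresh
      open Touched
      k : Fin n
      k = C a
      open Relabel C v k
      Ck : C k ≡ k
      Ck = Forest.idem forest a
      m′ : Fin 4 → ℕ → Value n
      m′ = linkMem v a k (N k) l m
      C′ N′ : Fin n → Fin n
      C′ = relabel C v k
      N′ = exchange N k v
      k≢v : k ≢ v
      k≢v p = irrefl G (subst (λ z → Edge G z v) (alone fv p) av)
      k-touched : Touched m C N T k
      k-touched = name-touched ta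
      labels₀ : Fin 4 → ℕ → Value n
      labels₀ = write labelᵇ (toℕ v) (word (toℕ k)) m
      nexts₁ : Fin 4 → ℕ → Value n
      nexts₁ = write nextᵇ (toℕ k) (word (toℕ v)) labels₀
      same-label : ∀ {z} → z ≢ v → m′ labelᵇ (toℕ z) ≡ m labelᵇ (toℕ z)
      same-label z≢v = write-miss labelᵇ (word (toℕ k)) m (z≢v ∘ toℕ-injective)
      same-next : ∀ {z} → z ≢ v → z ≢ k → m′ nextᵇ (toℕ z) ≡ m nextᵇ (toℕ z)
      same-next z≢v z≢k = trans (write-miss nextᵇ (word (toℕ (N k))) nexts₁ (z≢v ∘ toℕ-injective))
                                (write-miss nextᵇ (word (toℕ v)) labels₀ (z≢k ∘ toℕ-injective))
      v-touched : Touched m′ C′ N′ (v ∷ T) v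
      v-touched = record
        { label    = trans (write-hit labelᵇ (toℕ v) m) (cong (word ∘ toℕ) (sym (relabel-hit (own fv))))
        ; succ     = trans (write-hit nextᵇ (toℕ v) nexts₁) (cong (word ∘ toℕ) (sym (exchange-right N k≢v)))
        ; positive = subst (λ z → 0 < toℕ z) (sym (relabel-hit (own fv))) (positive ta)
        ; counted  = here refl
        }
      touched : ∀ {z} → Touched m C N T z → Touched m′ C′ N′ (v ∷ T) z
      touched {z} t = record
        { label    = trans (same-label z≢v) (trans (label t) (cong (word ∘ toℕ) (sym C′z)))
        ; succ     = succ′ (z ≟ k)
        ; positive = subst (λ y → 0 < toℕ y) (sym C′z) (positive t)
        ; counted  = there (counted t) }
        where
        z≢v : z ≢ v
        z≢v refl = ¬Fresh×Touched fv t
        C′z : C′ z ≡ C z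
        C′z = relabel-miss (z≢v ∘ alone fv)
        succ′ : Dec (z ≡ k) → m′ nextᵇ (toℕ z) ≡ word (toℕ (N′ z))
        succ′ (no z≢k) = trans (same-next z≢v z≢k) (trans (succ t) (cong (word ∘ toℕ) (sym (exchange-other N k≢v z≢k z≢v))))
        succ′ (yes refl) = trans (write-miss nextᵇ (word (toℕ (N k))) nexts₁ (k≢v ∘ toℕ-injective))
          (trans (write-hit nextᵇ (toℕ k) labels₀)
            (cong (word ∘ toℕ) (sym (trans (exchange-left N k≢v) (loop fv)))))
      status′ : ∀ z → Fresh m′ C′ N′ z ⊎ Touched m′ C′ N′ (v ∷ T) z
      status′ z with z ≟ v | status z
      ... | yes refl | _      = inj₂ v-touched
      ... | no _     | inj₂ t = inj₂ (touched t)
      ... | no z≢v   | inj₁ f = inj₁ record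
        { unlabelled = trans (same-label z≢v) (unlabelled f)
        ; own        = trans (relabel-miss (z≢v ∘ trans (sym (own f)))) (own f)
        ; loop       = trans (exchange-other N k≢v z≢k z≢v) (loop f)
        ; alone      = alone′
        }
        where
        z≢k : z ≢ k
        z≢k refl = ¬Fresh×Touched f k-touched
        alone′ : ∀ {y} → C′ y ≡ z → y ≡ z
        alone′ {y} p with relabel-cases y
        ... | inj₁ (_ , q) = contradiction (trans (sym p) q) z≢k
        ... | inj₂ (_ , q) = alone f (trans (sym q) p)
      circles′ : ∀ {q} → C′ q ≡ q → Circle N′ C′ q
      circles′ {q} p with q ≟ k
      ... | yes refl = splice (k≢v ∘ sym) (proj₂ (circles Ck)) (circles (own fv))
      ... | no q≢k with relabel-cases q
      ...   | inj₁ (_ , e)  = contradiction (trans (sym p) e) q≢k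
      ...   | inj₂ (Cq≢v , e) = Circle-stays k≢v Ck (own fv) (λ { refl → Cq≢v (own fv) }) q≢k
                                  (circles (trans (sym e) p))

-- The second phase.

four-turns : ∀ h L → suc ((4 * h + 3) * suc L + L) ≡ 4 * suc h * suc L
four-turns = solve-∀

-- With L + 1 > 2m / n, the queue outlasts the 2m ticks of the second phase:
-- n / 4 edges went out before and at most n / 4 follow, and n / 2 were found.
queue-lasts : ∀ {n L h j f} → suc ((4 * h + 3) * suc L + L) ≤ n * suc L + j → j < suc L * n → n ≤ 2 * f → h < f
queue-lasts {n} {L} {h} {j} {f} paced j< half = ≰⇒> λ f≤h → <⇒≱ (begin-strict
  n * suc L + j            <⟨ +-monoʳ-< (n * suc L) j< ⟩
  n * suc L + suc L * n    ≡⟨ rearrange n (suc L) ⟩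
  2 * n * suc L            ≤⟨ *-monoˡ-≤ (suc L) (*-monoʳ-≤ 2 (≤-trans half (*-monoʳ-≤ 2 f≤h))) ⟩
  2 * (2 * h) * suc L      ≡⟨ cong (_* suc L) (*-assoc 2 2 h) ⟨
  4 * h * suc L            ≤⟨ *-monoˡ-≤ (suc L) (*-monoʳ-≤ 4 (n≤1+n h)) ⟩
  4 * suc h * suc L        ≡⟨ four-turns h L ⟨
  suc ((4 * h + 3) * suc L + L) ∎) paced
  where
  open ≤-Reasoning
  rearrange : ∀ a b → a * b + b * a ≡ 2 * a * b
  rearrange = solve-∀

module Sweeping {n} {G : Graph n} (A : AdjacencyLists G) (w : ℕ) (n<2^w : n < 2 ^ w)
  (D : ℚᵘ) (top : ℕ) (within : ∀ {k} → k ≤ top → (+ k ℚ./ 1) ℚ.≤ D)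
  (3<2^w : 3 < 2 ^ w) (connected : Connected G)
  (neighbour : ∀ v → ∃[ a ] ∃[ as ] adj A v ≡ a ∷ as)
  (L : ℕ) (L≤n : L ≤ n) (degrees< : sum (map (deg A) (allFin n)) < suc L * n)
  (K : ℕ) (40≤K : 40 ≤ K) (top≥ : 9 + K * (4 * suc L) ≤ top) where

  open Completion A w n<2^w D top within public

  total : ℕ
  total = sum (map (deg A) (allFin n))

  relax : ∀ {B B′ s sent} → B ≤ B′ → Completes B s sent → Completes B′ s sent
  relax B≤ = after B≤ done

  Pending-same : ∀ {F F′ : Frame n} {sent pend} → front F′ ≡ front F → tail F′ ≡ tail F → mem F′ ≡ mem F →
                 Pending F sent pend → Pending F′ sent pend
  Pending-same {F} {F′} {sent} {pend} f≡ l≡ m≡ P = record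
    { front≡ = trans f≡ front≡
    ; tail≡  = trans l≡ (trans tail≡ (cong (_+ length pend) (sym f≡)))
    ; queued = subst₂ (λ m k → Queued m k pend) (sym m≡) (sym f≡) queued
    }
    where open Pending P

  sweeping : Frame n → ℕ → ℕ → List (Fin n) → Fin n → Fin n → Frame n
  sweeping F t s as x₀ ρ =
    record F { cursor = n; tick = t; turn = s; limit = L; p = ref as; x = word (toℕ x₀); root = word (toℕ ρ) }

  -- M is the label array.  An absorbed component is redirected by changing the label of its
  -- name only, so names are found in two hops.
  record Sweep (m : Fin 4 → ℕ → Value n) (es : List (Fin n × Fin n)) (C N M : Fin n → Fin n)
               (ρ x₀ : Fin n) (todo seen : List (Fin n)) : Set where
    field
      forest  : Forest G es C
      labels  : ∀ z → m labelᵇ (toℕ z) ≡ word (toℕ (M z))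
      nexts   : ∀ z → m nextᵇ (toℕ z) ≡ word (toℕ (N z))
      twice   : ∀ z → M (M z) ≡ C z
      direct  : ∀ {z} → C z ≢ ρ → M z ≡ C z
      fixed   : M ρ ≡ ρ
      walk    : Walk N C ρ x₀ todo seen
      origin  : ρ ∈ x₀ ∷ seen
      circles : ∀ {q} → C q ≡ q → q ≢ ρ → Circle N C q
      closed  : ∀ {y z} → y ∈ seen → Edge G y z → C z ≡ ρ
      half    : n ≤ 2 * length es

  -- The state inside one adjacency list: `as` is its unread part, and the neighbours already read
  -- lie in the component of the root.
  Covered : (Fin n → Fin n) → Fin n → Fin n → List (Fin n) → Set
  Covered C ρ x₀ as = (∀ {z} → Edge G x₀ z → C z ≡ ρ ⊎ z ∈ as) × (∀ {z} → z ∈ as → Edge G x₀ z)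

  -- The vertices of the absorbed class carry the label `k` by `direct`, and `M k` becomes `ρ`, so
  -- two hops lead from them to `ρ`. Chains grow no further because `ρ` always absorbs and is never
  -- absorbed.
  absorb : ∀ {m es C N M ρ x₀ todo seen a l} → Sweep m es C N M ρ x₀ todo seen → Edge G x₀ a → C a ≢ ρ →
           let k = C a in
           ∃[ todo′ ] Sweep (absorbMem x₀ a k ρ (N x₀) (N k) l m) (es ∷ʳ (x₀ , a))
                            (relabel C k ρ) (exchange N x₀ k) (M [ k ↦ ρ ]) ρ x₀ todo′ seen
  absorb {m} {es} {C} {N} {M} {ρ} {x₀} {todo} {seen} {a} {l} S xa Ca≢ρ = proj₁ spliced , record
    { forest  = subst (λ r → Forest G (es ∷ʳ (x₀ , a)) (relabel C k r)) Cx
                  (Forest-∷ʳ forest xa (λ q → Ca≢ρ (trans (sym q) Cx)))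
    ; labels  = λ z → labels′ z (z ≟ k)
    ; nexts   = λ z → nexts′ z (z ≟ x₀) (z ≟ k)
    ; twice   = λ z → twice′ z (z ≟ k) (M z ≟ k)
    ; direct  = direct′
    ; fixed   = trans (update-miss M k (Ca≢ρ ∘ sym)) fixed
    ; walk    = proj₂ spliced
    ; origin  = origin
    ; circles = circles′
    ; closed  = λ y∈ yz → stays (closed y∈ yz)
    ; half    = ≤-trans half (*-monoʳ-≤ 2 (subst (length es ≤_) (sym (length-++ es)) (m≤m+n _ 1)))
    }
    where
    open Sweep S
    k : Fin n
    k = C a
    open Relabel C k ρ
    Cx : C x₀ ≡ ρ
    Cx = Members.sound (Walk.members walk) (here refl)
    Ck : C k ≡ k
    Ck = Forest.idem forest a
    Mk : M k ≡ k
    Mk = trans (direct (Ca≢ρ ∘ trans (sym Ck))) Ck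
    x≢k : x₀ ≢ k
    x≢k p = Ca≢ρ (trans (sym Ck) (trans (cong C (sym p)) Cx))
    spliced : _
    spliced = splice Ca≢ρ walk (circles Ck Ca≢ρ)
    queues labels₁ nexts₁ : Fin 4 → ℕ → Value n
    queues  = write queue₂ᵇ l (word (toℕ a)) (write queue₁ᵇ l (word (toℕ x₀)) m)
    labels₁ = write labelᵇ (toℕ k) (word (toℕ ρ)) queues
    nexts₁  = write nextᵇ (toℕ x₀) (word (toℕ (N k))) labels₁
    m′ : Fin 4 → ℕ → Value n
    m′ = absorbMem x₀ a k ρ (N x₀) (N k) l m
    stays : ∀ {z} → C z ≡ ρ → relabel C k ρ z ≡ ρ
    stays q = trans (relabel-miss (λ p → Ca≢ρ (trans (sym p) q))) q
    labels′ : ∀ z → Dec (z ≡ k) → m′ labelᵇ (toℕ z) ≡ word (toℕ ((M [ k ↦ ρ ]) z))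
    labels′ z (yes refl) = trans (write-hit labelᵇ (toℕ k) queues) (cong (word ∘ toℕ) (sym (update-hit M k refl)))
    labels′ z (no z≢k)   = trans (write-miss labelᵇ (word (toℕ ρ)) queues (z≢k ∘ toℕ-injective))
                             (trans (labels z) (cong (word ∘ toℕ) (sym (update-miss M k z≢k))))
    nexts′ : ∀ z → Dec (z ≡ x₀) → Dec (z ≡ k) → m′ nextᵇ (toℕ z) ≡ word (toℕ (exchange N x₀ k z))
    nexts′ z _ (yes refl) = trans (write-hit nextᵇ (toℕ k) nexts₁) (cong (word ∘ toℕ) (sym (exchange-right N x≢k)))
    nexts′ z (yes refl) (no z≢k) = trans (write-miss nextᵇ (word (toℕ (N x₀))) nexts₁ (z≢k ∘ toℕ-injective))
      (trans (write-hit nextᵇ (toℕ x₀) labels₁) (cong (word ∘ toℕ) (sym (exchange-left N x≢k))))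
    nexts′ z (no z≢x) (no z≢k) = trans (write-miss nextᵇ (word (toℕ (N x₀))) nexts₁ (z≢k ∘ toℕ-injective))
      (trans (write-miss nextᵇ (word (toℕ (N k))) labels₁ (z≢x ∘ toℕ-injective))
        (trans (nexts z) (cong (word ∘ toℕ) (sym (exchange-other N x≢k z≢x z≢k)))))
    M′ : Fin n → Fin n
    M′ = M [ k ↦ ρ ]
    twice′ : ∀ z → Dec (z ≡ k) → Dec (M z ≡ k) → M′ (M′ z) ≡ relabel C k ρ z
    twice′ z (yes refl) _ = trans (cong M′ (update-hit M k refl))
      (trans (trans (update-miss M k (Ca≢ρ ∘ sym)) fixed) (sym (relabel-hit Ck)))
    twice′ z (no z≢k) (yes Mz) = trans (cong M′ (trans (update-miss M k z≢k) Mz))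
      (trans (update-hit M k refl) (sym (relabel-hit (trans (sym (twice z)) (trans (cong M Mz) Mk)))))
    -- Such a `z` is outside the class of `k`: inside it, `direct` would make `M z` equal to `k`.
    twice′ z (no z≢k) (no Mz≢k) = trans (cong M′ (update-miss M k z≢k))
      (trans (update-miss M k Mz≢k)
        (trans (twice z) (sym (relabel-miss (λ q → Mz≢k (trans (direct (λ p → Ca≢ρ (trans (sym q) p))) q))))))
    direct′ : ∀ {z} → relabel C k ρ z ≢ ρ → M′ z ≡ relabel C k ρ z
    direct′ {z} p with relabel-cases z
    ... | inj₁ (_ , e)    = contradiction e p
    ... | inj₂ (Cz≢k , e) = trans (update-miss M k (λ { refl → Cz≢k Ck }))
                              (trans (direct (p ∘ trans e)) (sym e))
    circles′ : ∀ {q} → relabel C k ρ q ≡ q → q ≢ ρ → Circle (exchange N x₀ k) (relabel C k ρ) q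
    circles′ {q} p q≢ρ with relabel-cases q
    ... | inj₁ (_ , e)    = contradiction (trans (sym p) e) q≢ρ
    ... | inj₂ (Cq≢k , e) = Circle-stays x≢k Cx Ck (λ { refl → Cq≢k Ck }) q≢ρ (circles (trans (sym e) p) q≢ρ)

  visit : ∀ {B F t s sent pend C N M ρ x₀ todo seen a as} → Pending F sent pend →
    Sweep (mem F) (sent ++ pend) C N M ρ x₀ todo seen → Edge G x₀ a →
    (∀ F′ pend′ C′ N′ M′ todo′ → Pending F′ sent pend′ →
      Sweep (mem F′) (sent ++ pend′) C′ N′ M′ ρ x₀ todo′ seen → C′ a ≡ ρ → (∀ {z} → C z ≡ ρ → C′ z ≡ ρ) →
      Completes B (at 65 (sweeping F′ t s (a ∷ as) x₀ ρ)) sent) →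
    Completes (12 + B) (at 53 (sweeping F t s (a ∷ as) x₀ ρ)) sent
  visit {B} {F} {t} {s} {sent} {pend} {C} {N} {M} {ρ} {x₀} {todo} {seen} {a} {as} P S xa cont with C a ≟ ρ
  ... | yes Ca = after (+-monoˡ-≤ B {4} {12} (m≤m+n 4 8))
    (old-run {F = sweeping F t s (a ∷ as) x₀ ρ} (labels a)
      (trans (labels (M a)) (cong (word ∘ toℕ) (trans (twice a) Ca))))
    (cont (record F { u = word (toℕ a); r = word (toℕ (M a)); t = word (toℕ ρ) }) pend C N M todo
      (Pending-same refl refl refl P) S Ca id)
    where open Sweep S
  ... | no Ca≢ρ = after ≤-refl
    (absorb-run {F = sweeping F t s (a ∷ as) x₀ ρ}
      (trans (labels a) (cong (word ∘ toℕ) (direct Ca≢ρ)))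
      (trans (labels (C a)) (cong (word ∘ toℕ) (trans (direct (Ca≢ρ ∘ trans (sym Ck))) Ck)))
      Ca≢ρ tail<n (nexts x₀) (nexts (C a)))
    (cont F′ (pend ∷ʳ (x₀ , a)) _ _ _ (proj₁ absorbed)
      (Pending-push P refl refl
        (λ i i< → write-miss queue₁ᵇ (word (toℕ x₀)) (mem F) (<⇒≢ i<))
        (λ i i< → write-miss queue₂ᵇ (word (toℕ a)) queue₁ (<⇒≢ i<))
        (write-hit queue₁ᵇ (tail F) (mem F))
        (write-hit queue₂ᵇ (tail F) queue₁))
      (subst (λ es → Sweep (mem F′) es _ _ _ ρ x₀ (proj₁ absorbed) seen)
        (++-assoc sent pend _) (proj₂ absorbed))
      (Relabel.relabel-hit C (C a) ρ refl)
      (λ q → trans (Relabel.relabel-miss C (C a) ρ (λ p → Ca≢ρ (trans (sym p) q))) q))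
    where
    open Sweep S
    Ck : C (C a) ≡ C a
    Ck = Forest.idem forest a
    tail<n : tail F < n
    tail<n = subst (_< n) (length-found P) (length-Forest< forest Ck)
    absorbed : _
    absorbed = absorb {l = tail F} S xa Ca≢ρ
    queue₁ : Fin 4 → ℕ → Value n
    queue₁ = write queue₁ᵇ (tail F) (word (toℕ x₀)) (mem F)
    F′ : Frame n
    F′ = record F { u = word (toℕ (N (C a))); r = word (toℕ (C a)); t = word (toℕ (N x₀))
                  ; tail = suc (tail F); mem = absorbMem x₀ a (C a) ρ (N x₀) (N (C a)) (tail F) (mem F) }

  module _ {m es C N M ρ x₀ todo seen} (S : Sweep m es C N M ρ x₀ todo seen) where

    open Sweep S
    open Walk walk
    open Members

    -- The vertices of a walk are distinct, so no adjacency list is read twice. This bounds the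
    -- number of entries read and hence the fuel.
    seen-degrees≤ : sum (map (deg A) seen) + deg A x₀ ≤ total
    seen-degrees≤ = begin
      sum (map (deg A) seen) + deg A x₀                            ≡⟨ +-comm (sum (map (deg A) seen)) _ ⟩
      deg A x₀ + sum (map (deg A) seen)                            ≤⟨ +-monoʳ-≤ (deg A x₀) (m≤n+m _ _) ⟩
      deg A x₀ + (sum (map (deg A) todo) + sum (map (deg A) seen)) ≡⟨ cong (λ d → deg A x₀ + d) (sym split) ⟩
      sum (map (deg A) (x₀ ∷ todo ++ seen))                        ≤⟨ sum-map-mono-⊆ (deg A) (unique members) (λ {z} _ → ∈-allFin z) ⟩
      total                                                        ∎
      where
      open ≤-Reasoning
      split : sum (map (deg A) (todo ++ seen)) ≡ sum (map (deg A) todo) + sum (map (deg A) seen)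
      split = trans (cong sum (map-++ (deg A) todo seen)) (sum-++ (map (deg A) todo) _)

    root≢ : ∀ {y todo′} → todo ≡ y ∷ todo′ → y ≢ ρ
    root≢ refl refl with origin | unique members
    ... | here refl  | u = Unique-head u (here refl)
    ... | there ρ∈   | u = Unique-head (Unique.drop⁺ 1 u) (∈-++⁺ʳ _ ρ∈)

    -- Once every member is processed, the component of `ρ` is closed under edges, so by
    -- connectedness it contains every vertex.
    one-tree : todo ≡ [] → Covered C ρ x₀ [] → ∀ u v → C u ≡ C v
    one-tree refl (cov , _) u v = trans (everywhere u) (sym (everywhere v))
      where
      spread : ∀ {y z} → y ∈ x₀ ∷ seen → Edge G y z → C z ≡ ρ
      spread (here refl) yz with cov yz
      ... | inj₁ p = p
      spread (there y∈) yz = closed y∈ yz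
      reach : ∀ {y z} → C y ≡ ρ → Star (Edge G) y z → C z ≡ ρ
      reach Cy ε        = Cy
      reach Cy (e ◅ es) = reach (spread (complete members Cy) e) es
      everywhere : ∀ z → C z ≡ ρ
      everywhere z = reach (sound members (here refl)) (connected x₀ z)

  module _ where
    open Sweep
    open Walk

    Sweep-advance : ∀ {m es C N M ρ x₀ y todo seen} → Sweep m es C N M ρ x₀ (y ∷ todo) seen →
                    Covered C ρ x₀ [] → Sweep m es C N M ρ y todo (x₀ ∷ seen)
    Sweep-advance S (cov , _) = record
      { forest = forest S ; labels = labels S ; nexts = nexts S ; twice = twice S
      ; direct = direct S ; fixed = fixed S ; walk = Walk-advance (walk S)
      ; origin = there (origin S) ; circles = circles S ; closed = closed′ ; half = half S }
      where
      closed′ : ∀ {y z} → y ∈ _ → Edge G y z → _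
      closed′ (here refl) yz with cov yz
      ... | inj₁ p = p
      closed′ (there y∈) yz = closed S y∈ yz

  adj-Covered : ∀ {C ρ} y → Covered C ρ y (adj A y)
  adj-Covered y = (λ {z} e → inj₂ (Equivalence.from (correct A y z) e)) , (λ {z} z∈ → Equivalence.to (correct A y z) z∈)

  adj≢[] : ∀ y → adj A y ≢ []
  adj≢[] y p with neighbour y
  ... | a , as , q with trans (sym p) q
  ...   | ()

  -- `K * g` is the time allowed for `g` ticks. The work paid for by one application is at most 28
  -- instructions per entry of the second phase, 33 per vertex of the first and 39 at the
  -- changeover, whence the 40.
  K-step : ∀ c g → c ≤ 40 → c + K * g ≤ K * suc g
  K-step c g c≤ = ≤-trans (+-monoˡ-≤ (K * g) (≤-trans c≤ 40≤K)) (≤-reflexive (sym (*-suc K g)))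

  -- The highest reading of the clock, `3 * suc L + L`, is one short of the period.
  ticks-left : ∀ {s t g} → t ≤ L → s ≤ 3 → s * suc L + t + g ≡ 4 * suc L → ∃[ g′ ] g ≡ suc g′
  ticks-left {g = suc g} _ _ _ = g , refl
  ticks-left {s} {t} {zero} t≤ s≤ p = contradiction
    (≤-<-trans (+-mono-≤ (*-monoˡ-≤ (suc L) s≤) t≤) (subst (3 * suc L + L <_) (four L) ≤-refl))
    (<-irrefl (trans (sym (+-identityʳ _)) p))
    where
    four : ∀ L → suc (3 * suc L + L) ≡ 4 * suc L
    four = solve-∀

  mutual
    -- `j` counts the adjacency entries read, `fuel` those that may follow, and `g` the ticks left
    -- before the next emission. The inequality between `length sent` and `j` says that the clock
    -- has made at most `suc L` ticks per vertex of the first phase and one per entry read since.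
    loop₂ : ∀ fuel j {F sent pend C N M ρ x₀ todo seen a as t s} g → fuel + j ≡ total →
      Pending F sent pend → Sweep (mem F) (sent ++ pend) C N M ρ x₀ todo seen → Covered C ρ x₀ (a ∷ as) →
      sum (map (deg A) seen) + deg A x₀ ≡ j + suc (length as) →
      (4 * length sent + s) * suc L + t ≤ n * suc L + j → t ≤ L → s ≤ 3 → s * suc L + t + g ≡ 4 * suc L →
      Completes (K * g) (at 53 (sweeping F t s (a ∷ as) x₀ ρ)) sent
    -- All `total` entries would have been read, yet one more is at hand.
    loop₂ zero j {as = as} g fuel P S cov work paced t≤ s≤ left =
      contradiction (≤-trans (≤-reflexive (sym work)) (seen-degrees≤ S))
        (<⇒≱ (subst (_< j + suc (length as)) fuel (m<m+n j (s≤s z≤n))))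
    loop₂ (suc fuel) j {sent = sent} {C = C} {ρ = ρ} {x₀} {seen = seen} {a} {as} {t} {s} g fuel≡ P S cov work paced t≤ s≤ left
      with ticks-left t≤ s≤ left
    ... | g′ , refl = relax (K-step 28 g′ (m≤m+n 28 12)) (visit P S (proj₂ cov (here refl)) continue)
      where
      fuel′ : fuel + suc j ≡ total
      fuel′ = trans (+-suc fuel j) fuel≡
      paced′ : suc ((4 * length sent + s) * suc L + t) ≤ n * suc L + suc j
      paced′ = subst (suc ((4 * length sent + s) * suc L + t) ≤_) (sym (+-suc (n * suc L) j)) (s≤s paced)
      continue : ∀ F′ pend′ C′ N′ M′ todo′ → Pending F′ sent pend′ →
        Sweep (mem F′) (sent ++ pend′) C′ N′ M′ ρ x₀ todo′ seen → C′ a ≡ ρ → (∀ {z} → C z ≡ ρ → C′ z ≡ ρ) →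
        Completes (16 + K * g′) (at 65 (sweeping F′ t s (a ∷ as) x₀ ρ)) sent
      continue F′ pend′ C′ N′ M′ todo′ P′ S′ C′a mono = go as refl todo′ refl
        where
        cov′ : ∀ {z} → Edge G x₀ z → C′ z ≡ ρ ⊎ z ∈ as
        cov′ e with proj₁ cov e
        ... | inj₁ p           = inj₁ (mono p)
        ... | inj₂ (here refl) = inj₁ C′a
        ... | inj₂ (there z∈)  = inj₂ z∈
        go : ∀ bs → bs ≡ as → ∀ ys → ys ≡ todo′ → Completes (16 + K * g′) (at 65 (sweeping F′ t s (a ∷ bs) x₀ ρ)) sent
        go (b ∷ bs) refl _ _ = after (+-monoˡ-≤ (K * g′) {13} {16} (m≤m+n 13 3))
          (next-run {F = sweeping F′ t s (a ∷ b ∷ bs) x₀ ρ})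
          (resume fuel (suc j) (b ∷ bs) (λ ()) g′ fuel′ P′ S′ (cov′ , proj₂ cov ∘ there)
            (trans work (+-suc j (suc (length bs)))) paced′ t≤ s≤ left)
        -- Four steps lead to the flush, whose first edge takes at most five more.
        go [] refl [] refl = after (+-monoʳ-≤ 9 (≤-trans z≤n (m≤n+m (K * g′) 7)))
          (last-run {F = sweeping F′ t s (a ∷ []) x₀ ρ} ▷
           stop-run {F = sweeping F′ t s [] x₀ ρ} (trans (nexts x₀) (cong (word ∘ toℕ) path)))
          (flush pend′ (Pending-same refl refl refl P′) forest (one-tree S′ refl (cov′ , λ ())) x₀
            (≤-trans (m≤m+n 6 3) (≤-trans (m≤m+n 9 (K * (4 * suc L))) top≥)))
          where
          open Sweep S′
          open Walk walk
        go [] refl (y ∷ ys) refl = after ≤-refl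
          (last-run {F = sweeping F′ t s (a ∷ []) x₀ ρ} ▷
           advance-run {F = sweeping F′ t s [] x₀ ρ} (trans (nexts x₀) (cong (word ∘ toℕ) (proj₁ path))) (root≢ S′ refl))
          (resume fuel (suc j) (adj A y) (adj≢[] y) g′ fuel′ P′ (Sweep-advance S′ (cov′ , λ ())) (adj-Covered y)
            (cong (_+ deg A y) (trans (+-comm (deg A x₀) _) (trans work (+-comm j 1))))
            paced′ t≤ s≤ left)
          where
          open Sweep S′
          open Walk walk

    -- The point just before a tick of the clock, hence the `suc` in the pacing inequality and in
    -- the ticks left. It is reached after each entry and also from the end of the first phase.
    resume : ∀ fuel j {F sent pend C N M ρ x₀ todo seen t s} as → as ≢ [] → ∀ g → fuel + j ≡ total →
      Pending F sent pend → Sweep (mem F) (sent ++ pend) C N M ρ x₀ todo seen → Covered C ρ x₀ as →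
      sum (map (deg A) seen) + deg A x₀ ≡ j + length as →
      suc ((4 * length sent + s) * suc L + t) ≤ n * suc L + j → t ≤ L → s ≤ 3 → s * suc L + t + suc g ≡ 4 * suc L →
      Completes (10 + K * g) (at 39 (sweeping F t s as x₀ ρ)) sent
    resume fuel j [] p = contradiction refl p
    resume fuel j {F} {sent} {pend} {C} {N} {M} {ρ} {x₀} {todo} {seen} {t} {s} (a ∷ as) _ g fuel≡ P S cov work paced t≤ s≤ left =
      pace {F = sweeping F t s (a ∷ as) x₀ ρ} (Pending-same refl refl refl P) t≤ s≤ L≤n 3<2^w
        (length-Forest< forest (Forest.idem forest x₀))
        nonempty quiet loud
      where
      open Sweep S
      h : ℕ
      h = length sent
      j< : j < suc L * n
      j< = ≤-<-trans (≤-trans (m≤n+m j fuel) (≤-reflexive fuel≡)) degrees<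
      nonempty : s ≡ 3 → t ≡ L → front F < length (sent ++ pend)
      nonempty refl refl = subst (_< length (sent ++ pend)) (sym (Pending.front≡ P))
        (queue-lasts {n} {L} {h} {j} paced j< half)
      quiet : ∀ t′ s′ → t′ ≤ L → s′ ≤ 3 → s′ * suc L + t′ ≡ suc (s * suc L + t) →
              Completes (2 + K * g) (at 47 (sweeping F t′ s′ (a ∷ as) x₀ ρ)) sent
      quiet t′ s′ t′≤ s′≤ e = after ≤-refl (phase₂-run {F = sweeping F t′ s′ (a ∷ as) x₀ ρ} ≤-refl)
        (loop₂ fuel j g fuel≡ P S cov work
          (subst (_≤ n * suc L + j) (sym (trans (regroup h s′ L t′) (trans (cong (λ i → 4 * h * suc L + i) e) (regroup′ h s L t)))) paced)
          t′≤ s′≤ (trans (cong (_+ g) e) (trans (sym (+-suc (s * suc L + t) g)) left)))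
        where
        regroup : ∀ h s L t → (4 * h + s) * suc L + t ≡ 4 * h * suc L + (s * suc L + t)
        regroup = solve-∀
        regroup′ : ∀ h s L t → 4 * h * suc L + suc (s * suc L + t) ≡ suc ((4 * h + s) * suc L + t)
        regroup′ = solve-∀
      loud : ∀ b c pend′ → pend ≡ (b , c) ∷ pend′ → s ≡ 3 → t ≡ L →
             Completes top (at 47 (sweeping (record F { u = word (toℕ b); t = word (toℕ c); front = suc (front F) })
               0 0 (a ∷ as) x₀ ρ)) (sent ∷ʳ (b , c))
      loud b c pend′ refl refl refl = after (≤-trans (+-monoˡ-≤ (K * (4 * suc L)) (m≤m+n 2 7)) top≥)
        (phase₂-run {F = sweeping F′ 0 0 (a ∷ as) x₀ ρ} ≤-refl)
        (loop₂ fuel j (4 * suc L) fuel≡ (Pending-pop {F′ = F′} P refl refl refl refl)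
          (subst (λ es → Sweep (mem F) es C N M ρ x₀ todo seen) (sym (++-assoc sent ((b , c) ∷ []) pend′)) S)
          cov work
          (subst (_≤ n * suc L + j) (trans (four-turns h L)
            (trans (sent-more h L) (cong (λ i → (4 * i + 0) * suc L + 0) (trans (+-comm 1 h) (sym (length-++ sent)))))) paced)
          z≤n z≤n refl)
        where
        F′ : Frame n
        F′ = record F { u = word (toℕ b); t = word (toℕ c); front = suc (front F) }
        sent-more : ∀ h L → 4 * suc h * suc L ≡ (4 * suc h + 0) * suc L + 0
        sent-more = solve-∀

-- The first phase.

-- Identifies the quotient accumulated by the program with the `L` on which the delay bound rests.
quotient-unique : ∀ {n a b r s} → r < n → s < n → a * n + r ≡ b * n + s → a ≡ b
quotient-unique {n} {a} {b} r< s< p = ≤-antisym (bound s< p) (bound r< (sym p))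
  where
  bound : ∀ {a b r s} → s < n → a * n + r ≡ b * n + s → a ≤ b
  bound {a} {b} {r} {s} s< p = ≤-pred (*-cancelʳ-< n a (suc b) (begin-strict
    a * n      ≤⟨ m≤m+n (a * n) r ⟩
    a * n + r  ≡⟨ p ⟩
    b * n + s  <⟨ +-monoʳ-< (b * n) s< ⟩
    b * n + n  ≡⟨ +-comm (b * n) n ⟩
    suc b * n  ∎))
    where open ≤-Reasoning

zero∈take : ∀ {n k} (a : Fin n) → toℕ a ≡ 0 → 0 < k → a ∈ take k (allFin n)
zero∈take {k = suc k} zero _ _ = here refl

module Scanning {n} {G : Graph n} (A : AdjacencyLists G) (w : ℕ) (n<2^w : n < 2 ^ w)
  (D : ℚᵘ) (top : ℕ) (within : ∀ {k} → k ≤ top → (+ k ℚ./ 1) ℚ.≤ D)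
  (3<2^w : 3 < 2 ^ w) (connected : Connected G)
  (neighbour : ∀ v → ∃[ a ] ∃[ as ] adj A v ≡ a ∷ as)
  (L : ℕ) (L≤n : L ≤ n) (R : ℕ) (R<n : R < n) (degrees≡ : sum (map (deg A) (allFin n)) ≡ L * n + R)
  (K : ℕ) (40≤K : 40 ≤ K) (top≥ : 9 + K * (4 * suc L) ≤ top) where

  degrees< : sum (map (deg A) (allFin n)) < suc L * n
  degrees< = subst₂ _<_ (sym degrees≡) (+-comm (L * n) n) (+-monoʳ-< (L * n) R<n)

  open Sweeping A w n<2^w D top within 3<2^w connected neighbour L L≤n degrees< K 40≤K top≥ public

  scanning : Frame n → ℕ → ℕ → ℕ → ℕ → Frame n
  scanning F c s q r = record F { cursor = c; tick = 0; turn = s; limit = 0; quot = q; rest = r }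

  record Scan (k : ℕ) (m : Fin 4 → ℕ → Value n) (es : List (Fin n × Fin n))
              (C N : Fin n → Fin n) (T : List (Fin n)) : Set where
    field
      labelled : Labelled m es C N T
      seen     : ∀ {z} → z ∈ take k (allFin n) → Touched m C N T z
      small    : length T ≤ 2 * length es

  -- The scanned vertices all lie in `T`, and each edge came with at most two new labels. With `k`
  -- equal to `n`, this is the `half` of the second phase.
  scanned≤ : ∀ {k m es C N T} → k ≤ n → Scan k m es C N T → k ≤ 2 * length es
  scanned≤ {k} k≤n S = ≤-trans
    (≤-trans (≤-reflexive (sym (trans (length-take k (allFin n)) (trans (cong (k ⊓_) (length-tabulate {n = n} id)) (m≤n⇒m⊓n≡m k≤n)))))
      (length-mono-⊆ (Unique.take⁺ k (Unique.allFin⁺ n)) (Touched.counted ∘ seen)))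
    small
    where open Scan S

  seen-suc : ∀ {P : Fin n → Set} (v : Fin n) → (∀ {z} → z ∈ take (toℕ v) (allFin n) → P z) → P v →
             ∀ {z} → z ∈ take (suc (toℕ v)) (allFin n) → P z
  seen-suc v ps pv z∈ with ∈-++⁻ (take (toℕ v) (allFin n)) (subst (_ ∈_) (take-suc-tabulate id v) z∈)
  ... | inj₁ z∈′         = ps z∈′
  ... | inj₂ (here refl) = pv

  Pending-cong : ∀ {F F′ : Frame n} {sent pend} → front F′ ≡ front F → tail F′ ≡ tail F →
                 (∀ i → mem F′ queue₁ᵇ i ≡ mem F queue₁ᵇ i) → (∀ i → mem F′ queue₂ᵇ i ≡ mem F queue₂ᵇ i) →
                 Pending F sent pend → Pending F′ sent pend
  Pending-cong {F} {F′} {sent} {pend} f≡ l≡ m₁ m₂ P = record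
    { front≡ = trans f≡ front≡
    ; tail≡  = trans l≡ (trans tail≡ (cong (_+ length pend) (sym f≡)))
    ; queued = subst (λ k → Queued (mem F′) k pend) (sym f≡)
                 (Queued-cong (front F) pend (λ i _ → m₁ i) (λ i _ → m₂ i) queued)
    }
    where open Pending P

  module _ {B : ℕ} {v : Fin n} {s q r : ℕ} {sent : List (Fin n × Fin n)}
    (cont : ∀ F′ pend′ C′ N′ T′ → Pending F′ sent pend′ → Scan (suc (toℕ v)) (mem F′) (sent ++ pend′) C′ N′ T′ →
            Completes B (at 25 (scanning F′ (toℕ v) s q r)) sent) where

    -- The bound on `T` has a slack of one because the neighbour `a` may just have been labelled;
    -- the new edge pays for `a` and `v` together.
    linking : ∀ {F pend C N T a} → Pending F sent pend → Labelled (mem F) (sent ++ pend) C N T →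
      (∀ {z} → z ∈ take (toℕ v) (allFin n) → Touched (mem F) C N T z) → length T ≤ suc (2 * length (sent ++ pend)) →
      Edge G a v → Fresh (mem F) C N v → Touched (mem F) C N T a →
      Completes (7 + B) (at 18 (record (scanning F (toℕ v) s q r) { u = word (toℕ a); r = word (toℕ (C a)) })) sent
    linking {F} {pend} {C} {N} {T} {a} P I sn small av fv ta =
      after ≤-refl
        (link-run {F = scanning F (toℕ v) s q r} (Touched.succ (name-touched I ta)) tail<n)
        (cont F′ (pend ∷ʳ (a , v)) _ _ (v ∷ T)
          (Pending-push P refl refl
            (λ i i< → write-miss queue₁ᵇ (word (toℕ a)) nexts′ (<⇒≢ i<))
            (λ i i< → write-miss queue₂ᵇ (word (toℕ v)) queue₁ (<⇒≢ i<))
            (write-hit queue₁ᵇ (tail F) nexts′)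
            (write-hit queue₂ᵇ (tail F) queue₁))
          (subst (λ es → Scan (suc (toℕ v)) (mem F′) es _ _ (v ∷ T)) (++-assoc sent pend ((a , v) ∷ []))
            record { labelled = proj₁ linked′
                   ; seen     = seen-suc v (λ z∈ → proj₂ (proj₂ linked′) (sn z∈)) (proj₁ (proj₂ linked′))
                   ; small    = subst (suc (length T) ≤_)
                       (sym (trans (cong (2 *_) (trans (length-++ (sent ++ pend)) (+-comm _ 1))) (*-suc 2 _))) (s≤s small)
                   }))
      where
      linked′ : _
      linked′ = link I {l = tail F} av fv ta
      tail<n : tail F < n
      tail<n = subst (_< n) (length-found P) (length-Forest< (Labelled.forest I) (Fresh.own fv))
      nexts′ queue₁ : Fin 4 → ℕ → Value n
      nexts′ = write nextᵇ (toℕ v) (word (toℕ (N (C a)))) (write nextᵇ (toℕ (C a)) (word (toℕ v))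
                 (write labelᵇ (toℕ v) (word (toℕ (C a))) (mem F)))
      queue₁ = write queue₁ᵇ (tail F) (word (toℕ a)) nexts′
      F′ : Frame n
      F′ = record F { u = word (toℕ a); r = word (toℕ (C a)); t = word (toℕ (N (C a)))
                    ; tail = suc (tail F); mem = linkMem v a (C a) (N (C a)) (tail F) (mem F) }

    grow : ∀ {F pend C N T} → Pending F sent pend → Scan (toℕ v) (mem F) (sent ++ pend) C N T →
           Completes (16 + B) (at 9 (scanning F (toℕ v) s q r)) sent
    grow {F} {pend} {C} {N} {T} P S with neighbour v
    ... | a , as , adj≡ = go (status v) (status a)
      where
      open Scan S
      open Labelled labelled
      va : Edge G v a
      va = Equivalence.to (correct A v a) (subst (a ∈_) (sym adj≡) (here refl))
      a≢v : v ≢ a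
      a≢v refl = irrefl G va
      -- Label 0 stands for no label; no component is named 0 since vertex 0 joins its neighbour first.
      positive-fresh : Fresh (mem F) C N a → 0 < toℕ a
      positive-fresh fa = n≢0⇒n>0 (λ a≡0 → ¬Fresh×Touched fa
        (seen (zero∈take a a≡0 (n≢0⇒n>0 (λ v≡0 → a≢v (toℕ-injective (trans v≡0 (sym a≡0))))))))
      go : Fresh (mem F) C N v ⊎ Touched (mem F) C N T v → Fresh (mem F) C N a ⊎ Touched (mem F) C N T a →
           Completes (16 + B) (at 9 (scanning F (toℕ v) s q r)) sent
      go (inj₂ tv) _ = after (+-monoˡ-≤ B {4} {16} (m≤m+n 4 12))
        (skip-run {F = scanning F (toℕ v) s q r} adj≡ (Touched.label tv) (Touched.positive tv))
        (cont (record F { p = ref (adj A v); u = word (toℕ a); r = word (toℕ (C v)) }) pend C N T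
          (Pending-same refl refl refl P)
          record { labelled = labelled ; seen = seen-suc v seen tv ; small = small })
      go (inj₁ fv) (inj₂ ta) = after (+-monoˡ-≤ B {13} {16} (m≤m+n 13 3))
        (find-run {F = scanning F (toℕ v) s q r} adj≡ (Fresh.unlabelled fv) (Touched.label ta) (Touched.positive ta))
        (linking {F = record F { p = ref (adj A v) }} (Pending-same refl refl refl P) labelled seen
          (m≤n⇒m≤1+n small) (symm G va) fv ta)
      go (inj₁ fv) (inj₁ fa) with touch labelled fa (positive-fresh fa)
      ... | I′ , ta′ , fresh′ , touched′ = after ≤-refl
        (subst (λ y → SilentSteps 9 _ (at 18 (record (scanning F₁ (toℕ v) s q r) { u = word (toℕ a); r = word (toℕ y) })))
          (sym (Fresh.own fa))
          (touch-run {F = scanning F (toℕ v) s q r} adj≡ (Fresh.unlabelled fv) (Fresh.unlabelled fa)))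
        (linking {F = F₁} (Pending-cong refl refl (λ _ → refl) (λ _ → refl) P) I′ (touched′ ∘ seen)
          (s≤s small) (symm G va) (fresh′ a≢v fv) ta′)
        where
        F₁ : Frame n
        F₁ = record F { p = ref (adj A v); mem = touchMem a (mem F) }

  degreeSum : ℕ → ℕ
  degreeSum k = sum (map (deg A) (take k (allFin n)))

  degreeSum-suc : ∀ v → degreeSum (suc (toℕ v)) ≡ degreeSum (toℕ v) + deg A v
  degreeSum-suc v = begin
    sum (map (deg A) (take (suc (toℕ v)) (allFin n)))     ≡⟨ cong (sum ∘ map (deg A)) (take-suc-tabulate id v) ⟩
    sum (map (deg A) (take (toℕ v) (allFin n) ∷ʳ v))      ≡⟨ cong sum (map-++ (deg A) (take (toℕ v) (allFin n)) (v ∷ [])) ⟩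
    sum (map (deg A) (take (toℕ v) (allFin n)) ∷ʳ deg A v) ≡⟨ sum-++ (map (deg A) (take (toℕ v) (allFin n))) (deg A v ∷ []) ⟩
    degreeSum (toℕ v) + (deg A v + 0)                     ≡⟨ cong (λ d → degreeSum (toℕ v) + d) (+-identityʳ (deg A v)) ⟩
    degreeSum (toℕ v) + deg A v                           ∎
    where open ≡-Reasoning

  -- A degree is at most `n`, so one carry per vertex is enough and the quotient never exceeds the
  -- number of vertices counted.
  count : ∀ {B F sent s q r} (v : Fin n) → r < n → q ≤ toℕ v → degreeSum (toℕ v) ≡ q * n + r →
    (∀ u′ t′ q′ r′ → r′ < n → q′ ≤ suc (toℕ v) → degreeSum (suc (toℕ v)) ≡ q′ * n + r′ →
       Completes B (at 32 (scanning (record F { u = u′; t = t′ }) (toℕ v) s q′ r′)) sent) →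
    Completes (6 + B) (at 25 (scanning F (toℕ v) s q r)) sent
  count {B} {F} {sent} {s} {q} {r} v r<n q≤v sum≡ cont with deg A v <? n ∸ r
  ... | yes d< = after (+-monoˡ-≤ B {4} {6} (m≤m+n 4 2))
    (small-degree-run {F = scanning F (toℕ v) s q r} r<n d<)
    (cont (word (deg A v)) (word (n ∸ r)) q (r + deg A v)
      (subst (r + deg A v <_) (m+[n∸m]≡n (<⇒≤ r<n)) (+-monoʳ-< r d<)) (m≤n⇒m≤1+n q≤v)
      (trans (degreeSum-suc v) (trans (cong (_+ deg A v) sum≡) (+-assoc (q * n) r (deg A v)))))
  ... | no d≮ = after ≤-refl
    (large-degree-run {F = scanning F (toℕ v) s q r} r<n d≥ (≤-<-trans q≤v (toℕ<n v)))
    (cont (word (deg A v)) (word (n ∸ r)) (suc q) (deg A v ∸ (n ∸ r))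
      (≤-<-trans (≤-trans (∸-monoˡ-≤ (n ∸ r) (deg≤n v)) (≤-reflexive (m∸[m∸n]≡n (<⇒≤ r<n)))) r<n) (s≤s q≤v)
      (begin
        degreeSum (suc (toℕ v))                            ≡⟨ degreeSum-suc v ⟩
        degreeSum (toℕ v) + deg A v                        ≡⟨ cong₂ _+_ sum≡ (sym (m+[n∸m]≡n d≥)) ⟩
        q * n + r + (n ∸ r + (deg A v ∸ (n ∸ r)))          ≡⟨ regroup (q * n) r (n ∸ r) (deg A v ∸ (n ∸ r)) ⟩
        r + (n ∸ r) + q * n + (deg A v ∸ (n ∸ r))          ≡⟨ cong (λ i → i + q * n + (deg A v ∸ (n ∸ r))) (m+[n∸m]≡n (<⇒≤ r<n)) ⟩
        suc q * n + (deg A v ∸ (n ∸ r))                    ∎))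
    where
    open ≡-Reasoning
    d≥ : n ∸ r ≤ deg A v
    d≥ = ≮⇒≥ d≮
    regroup : ∀ a b c d → a + b + (c + d) ≡ b + c + a + d
    regroup = solve-∀

  -- All vertices are labelled directly by now, so the label array `M` starts out as `C` itself.
  rooted : ∀ {k m es C N T} → k ≡ n → Scan k m es C N T → ∀ ρ → C ρ ≡ ρ →
           ∃[ todo ] Sweep m es C N C ρ ρ todo []
  rooted {m = m} {C = C} {N} {T} refl S ρ Cρ = proj₁ (circles Cρ) , record
    { forest  = forest
    ; labels  = Touched.label ∘ all
    ; nexts   = Touched.succ ∘ all
    ; twice   = Forest.idem forest
    ; direct  = λ _ → refl
    ; fixed   = Cρ
    ; walk    = proj₂ (circles Cρ)
    ; origin  = here refl
    ; circles = λ p _ → circles p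
    ; closed  = λ ()
    ; half    = scanned≤ ≤-refl S
    }
    where
    open Scan S
    open Labelled labelled
    all : ∀ z → Touched m C N T z
    all z = seen (subst (z ∈_) (sym (take-all n (allFin n) (≤-reflexive (length-tabulate {n = n} id)))) (∈-allFin z))

  -- `fuel` counts the vertices after `v` and `g` the turns left after the present one. A turn is
  -- budgeted as `suc L` ticks, which lets the budget carry over into the second phase. `c` is
  -- separate from `toℕ v` because the next vertex, built by `fromℕ<`, has the number `suc (toℕ v)`
  -- only propositionally.
  loop₁ : ∀ fuel c (v : Fin n) {F sent pend C N T s q r} g → c ≡ toℕ v → toℕ v + suc fuel ≡ n →
    Pending F sent pend → Scan c (mem F) (sent ++ pend) C N T →
    r < n → q ≤ c → degreeSum c ≡ q * n + r → 4 * length sent + s ≡ c → s + suc g ≡ 4 →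
    Completes (K * (suc L * suc g)) (at 9 (scanning F c s q r)) sent

  loop₁ (suc fuel) _ v {F} {sent} {s = s} g refl fuel≡ P S r<n q≤ sum≡ paced left =
    relax budget
      (grow (λ F₁ pend₁ C₁ N₁ T₁ P₁ S₁ →
        count {F = F₁} v r<n q≤ sum≡ (λ u₁ t₁ q₁ r₁ r₁<n q₁≤ sum₁≡ →
          after ≤-refl (again-run {F = scanning (record F₁ { u = u₁; t = t₁ }) (toℕ v) s q₁ r₁} v′<n)
            (ticking P₁ S₁ r₁<n q₁≤ sum₁≡))) P S)
    where
    v′<n : suc (toℕ v) < n
    v′<n = subst (suc (toℕ v) <_) fuel≡ (subst (_< toℕ v + suc (suc fuel)) (+-comm (toℕ v) 1) (+-monoʳ-< (toℕ v) (s≤s (s≤s z≤n))))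
    fuel′≡ : toℕ (fromℕ< v′<n) + suc fuel ≡ n
    fuel′≡ = trans (cong (_+ suc fuel) (toℕ-fromℕ< v′<n)) (trans (sym (+-suc (toℕ v) (suc fuel))) fuel≡)
    budget : 33 + K * (suc L * g) ≤ K * (suc L * suc g)
    budget = ≤-trans (K-step 33 (suc L * g) (m≤m+n 33 7))
      (*-monoʳ-≤ K (subst (suc (suc L * g) ≤_) (sym (*-suc (suc L) g)) (s≤s (m≤n+m (suc L * g) L))))
    ticking : ∀ {F₁ pend₁ C₁ N₁ T₁ q₁ r₁} → Pending F₁ sent pend₁ → Scan (suc (toℕ v)) (mem F₁) (sent ++ pend₁) C₁ N₁ T₁ →
      r₁ < n → q₁ ≤ suc (toℕ v) → degreeSum (suc (toℕ v)) ≡ q₁ * n + r₁ → ∀ {u₁ t₁} →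
      Completes (9 + K * (suc L * g)) (at 39 (scanning (record F₁ { u = u₁; t = t₁ }) (suc (toℕ v)) s q₁ r₁)) sent
    ticking {F₁} {pend₁} {C₁} {N₁} {T₁} {q₁} {r₁} P₁ S₁ r₁<n q₁≤ sum₁≡ {u₁} {t₁} =
      pace {F = scanning F₂ (suc (toℕ v)) s q₁ r₁} (Pending-same refl refl refl P₁) z≤n s≤3 z≤n 3<2^w
        (length-Forest< forest (Forest.idem forest v)) nonempty quiet loud
      where
      open Labelled (Scan.labelled S₁)
      F₂ : Frame n
      F₂ = record F₁ { u = u₁; t = t₁ }
      s≤3 : s ≤ 3
      s≤3 = +-cancelʳ-≤ 1 s 3 (≤-trans (+-monoʳ-≤ s (s≤s z≤n)) (≤-reflexive left))
      sent-more : ∀ h → 4 * suc h ≡ suc (4 * h + 3)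
      sent-more = solve-∀
      -- With `h` edges sent, `4 * suc h` vertices have been scanned, so at least `2 * suc h` edges
      -- are known.
      nonempty : s ≡ 3 → 0 ≡ 0 → front F₁ < length (sent ++ pend₁)
      nonempty refl _ = subst (_< length (sent ++ pend₁)) (sym (Pending.front≡ P₁))
        (≤-trans (m≤n*m (suc (length sent)) 2) (*-cancelˡ-≤ 2 (begin
          2 * (2 * suc (length sent))  ≡⟨ *-assoc 2 2 (suc (length sent)) ⟨
          4 * suc (length sent)        ≡⟨ trans (sent-more (length sent)) (cong suc paced) ⟩
          suc (toℕ v)                  ≤⟨ scanned≤ (<⇒≤ v′<n) S₁ ⟩
          2 * length (sent ++ pend₁)   ∎)))
        where open ≤-Reasoning
      quiet : ∀ t′ s′ → t′ ≤ 0 → s′ ≤ 3 → s′ * 1 + t′ ≡ suc (s * 1 + 0) →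
        Completes (1 + K * (suc L * g)) (at 47 (record (scanning F₂ (suc (toℕ v)) s q₁ r₁) { tick = t′; turn = s′ })) sent
      quiet _ s′ z≤n s′≤3 e = advance-turn g left (trans (sym (trans (+-identityʳ _) (*-identityʳ s′))) (trans e (cong suc (trans (+-identityʳ _) (*-identityʳ s)))))
        where
        advance-turn : ∀ g → s + suc g ≡ 4 → s′ ≡ suc s →
          Completes (1 + K * (suc L * g)) (at 47 (record (scanning F₂ (suc (toℕ v)) s q₁ r₁) { tick = 0; turn = s′ })) sent
        advance-turn zero left′ refl = contradiction s′≤3 (<⇒≱ (≤-reflexive (trans (sym left′) (+-comm s 1))))
        advance-turn (suc g′) left′ refl = after ≤-refl (phase₁-run {F = scanning F₂ (suc (toℕ v)) (suc s) q₁ r₁} v′<n)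
          (loop₁ fuel (suc (toℕ v)) (fromℕ< v′<n) g′ (sym (toℕ-fromℕ< v′<n)) fuel′≡ (Pending-same {F′ = F₂} refl refl refl P₁) S₁
            r₁<n q₁≤ sum₁≡ (trans (+-suc _ s) (cong suc paced)) (trans (sym (+-suc s (suc g′))) left′))
      loud : ∀ a b pend′ → pend₁ ≡ (a , b) ∷ pend′ → s ≡ 3 → 0 ≡ 0 →
        Completes top (at 47 (record (scanning F₂ (suc (toℕ v)) s q₁ r₁)
          { tick = 0; turn = 0; u = word (toℕ a); t = word (toℕ b); front = suc (front F₁) })) (sent ∷ʳ (a , b))
      loud a b pend′ refl refl _ = after {B = K * (suc L * 4)}
        (≤-trans (+-mono-≤ (m≤m+n 1 8) (≤-reflexive (cong (K *_) (*-comm (suc L) 4)))) top≥)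
        (phase₁-run {F = scanning F₃ (suc (toℕ v)) 0 q₁ r₁} v′<n)
        (loop₁ fuel (suc (toℕ v)) (fromℕ< v′<n) 3 (sym (toℕ-fromℕ< v′<n)) fuel′≡
          (Pending-pop {F′ = F₃} P₁ refl refl refl refl)
          (subst (λ es → Scan (suc (toℕ v)) (mem F₁) es C₁ N₁ T₁) (sym (++-assoc sent ((a , b) ∷ []) pend′)) S₁)
          r₁<n q₁≤ sum₁≡
          (trans (+-identityʳ _) (trans (cong (4 *_) (trans (length-++ sent) (+-comm _ 1)))
            (trans (sent-more (length sent)) (cong suc paced))))
          refl)
        where
        F₃ : Frame n
        F₃ = record F₁ { u = word (toℕ a); t = word (toℕ b); front = suc (front F₁) }

  loop₁ zero _ v {F} {sent} {s = s} g refl fuel≡ P S r<n q≤ sum≡ paced left =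
    relax budget
      (grow (λ F₁ pend₁ C₁ N₁ T₁ P₁ S₁ →
        count {F = F₁} v r<n q≤ sum≡ (λ u₁ t₁ q₁ r₁ r₁<n q₁≤ sum₁≡ → starting P₁ S₁ r₁<n sum₁≡)) P S)
    where
    sv≡n : suc (toℕ v) ≡ n
    sv≡n = trans (+-comm 1 (toℕ v)) fuel≡
    0<n : 0 < n
    0<n = subst (0 <_) sv≡n (s≤s z≤n)
    s≤3 : s ≤ 3
    s≤3 = +-cancelʳ-≤ 1 s 3 (≤-trans (+-monoʳ-≤ s (s≤s z≤n)) (≤-reflexive left))
    -- The `suc g` turns left amount to `suc g * suc L` ticks, one of which is spent on leaving the
    -- last vertex.
    g₂ : ℕ
    g₂ = g * suc L + L
    budget : 39 + K * g₂ ≤ K * (suc L * suc g)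
    budget = ≤-trans (K-step 39 g₂ (m≤m+n 39 1)) (≤-reflexive (cong (K *_) (spread g L)))
      where
      spread : ∀ g L → suc (g * suc L + L) ≡ suc L * suc g
      spread = solve-∀
    left₂ : s * suc L + 0 + suc g₂ ≡ 4 * suc L
    left₂ = trans (spread s g L) (cong (_* suc L) left)
      where
      spread : ∀ s g L → s * suc L + 0 + suc (g * suc L + L) ≡ (s + suc g) * suc L
      spread = solve-∀
    -- The last vertex is already paced with limit `L`, so it moves the clock by one tick in place
    -- of a whole turn; hence an inequality.
    paced₂ : suc ((4 * length sent + s) * suc L + 0) ≤ n * suc L + 0
    paced₂ = ≤-trans (s≤s (≤-trans (≤-reflexive (trans (+-identityʳ _) (cong (_* suc L) paced))) (m≤n+m _ L)))
      (≤-reflexive (trans (cong (_* suc L) sv≡n) (sym (+-identityʳ _))))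
    starting : ∀ {F₁ pend₁ C₁ N₁ T₁ q₁ r₁} → Pending F₁ sent pend₁ → Scan (suc (toℕ v)) (mem F₁) (sent ++ pend₁) C₁ N₁ T₁ →
      r₁ < n → degreeSum (suc (toℕ v)) ≡ q₁ * n + r₁ → ∀ {u₁ t₁} →
      Completes (17 + K * g₂) (at 32 (scanning (record F₁ { u = u₁; t = t₁ }) (toℕ v) s q₁ r₁)) sent
    starting {F₁} {pend₁} {C₁} {N₁} {T₁} {q₁} {r₁} P₁ S₁ r₁<n sum₁≡ {u₁} {t₁} =
      after ≤-refl (setup-run {F = scanning F₂ (toℕ v) s q₁ r₁} (≤-reflexive (sym sv≡n)) 0<n label₀)
        (subst₂ (λ c l → Completes (10 + K * g₂)
            (at 39 (record F₂ { cursor = c; tick = 0; turn = s; limit = l; quot = q₁; rest = r₁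
                              ; p = ref (adj A ρ); x = word (toℕ ρ); root = word (toℕ ρ) })) sent)
          (sym sv≡n) (sym q₁≡L)
          (resume total 0 {F = record F₂ { quot = q₁; rest = r₁ }} (adj A ρ) (adj≢[] ρ) g₂ (+-identityʳ total)
            (Pending-same refl refl refl P₁)
            (proj₂ (rooted sv≡n S₁ ρ (Forest.idem forest z₀))) (adj-Covered ρ) refl paced₂ z≤n s≤3 left₂))
      where
      open Scan S₁
      open Labelled labelled
      F₂ : Frame n
      F₂ = record F₁ { u = u₁; t = t₁ }
      z₀ ρ : Fin n
      z₀ = fromℕ< 0<n
      ρ  = C₁ z₀
      label₀ : mem F₁ labelᵇ 0 ≡ word (toℕ ρ)
      label₀ = subst (λ i → mem F₁ labelᵇ i ≡ word (toℕ ρ)) (toℕ-fromℕ< 0<n)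
        (Touched.label (seen (zero∈take z₀ (toℕ-fromℕ< 0<n) (s≤s z≤n))))
      q₁≡L : q₁ ≡ L
      q₁≡L = quotient-unique r₁<n R<n (trans (sym sum₁≡)
        (trans (cong (sum ∘ map (deg A)) (take-all (suc (toℕ v)) (allFin n)
          (≤-reflexive (trans (length-tabulate {n = n} id) (sym sv≡n))))) degrees≡))

-- Constants, start of the program, and the theorem.

length≤sum : ∀ {A : Set} (f : A → ℕ) xs → (∀ x → 1 ≤ f x) → length xs ≤ sum (map f xs)
length≤sum f []       _  = z≤n
length≤sum f (x ∷ xs) 1≤ = +-mono-≤ (1≤ x) (length≤sum f xs 1≤)

sum≤length* : ∀ {A : Set} (f : A → ℕ) c xs → (∀ x → f x ≤ c) → sum (map f xs) ≤ length xs * c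
sum≤length* f c []       _  = z≤n
sum≤length* f c (x ∷ xs) ≤c = +-mono-≤ (≤c x) (sum≤length* f c xs ≤c)

-- Two vertices already force `w ≥ 2`, and then 3 fits into a word.
3<2^ : ∀ {n} w → 2 ≤ n → n < 2 ^ w → 3 < 2 ^ w
3<2^ zero          2≤n n< = contradiction (≤-trans (≤-trans (s≤s z≤n) 2≤n) (≤-pred n<)) (λ ())
3<2^ (suc zero)    2≤n n< = contradiction (≤-trans 2≤n (≤-pred n<)) (λ { (s≤s ()) })
3<2^ (suc (suc w)) _   _  = *-monoʳ-≤ 2 (*-monoʳ-≤ 2 (m^n>0 2 w))

prog-memory : ∀ {n} .{{_ : NonZero n}} (f : State prog n) → sizes f ≡ n ∷ n ∷ n ∷ n ∷ [] →
              Θ[ 338 ] (lazyMemory f) n × Θ[ 338 ] (space f) n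
prog-memory {n} f refl =
  (≤-trans (m≤n*m n 4) (m≤n*m (4 * n) 338) , *-monoˡ-≤ n (m≤m+n 4 334)) ,
  (≤-trans (≤-trans (m≤n*m n 4) (m≤n+m (4 * n) 18)) (m≤n*m (18 + 4 * n) 338) ,
   ≤-trans (+-monoˡ-≤ (4 * n) (m≤m*n 18 n)) (≤-trans (≤-reflexive (sym (*-distribʳ-+ n 18 4))) (*-monoˡ-≤ n (m≤m+n 22 316))))

module Launch {n′ : ℕ} {G : Graph (suc n′)} (A : AdjacencyLists G) (w : ℕ) (n<2^w : suc n′ < 2 ^ w)
  (D : ℚᵘ) (top : ℕ) (within : ∀ {k} → k ≤ top → (+ k ℚ./ 1) ℚ.≤ D)
  (3<2^w : 3 < 2 ^ w) (connected : Connected G)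
  (neighbour : ∀ v → ∃[ a ] ∃[ as ] adj A v ≡ a ∷ as)
  (L : ℕ) (L≤n : L ≤ suc n′) (R : ℕ) (R<n : R < suc n′)
  (degrees≡ : sum (map (deg A) (allFin (suc n′))) ≡ L * suc n′ + R)
  (K : ℕ) (40≤K : 40 ≤ K) (top≥ : 9 + K * (4 * suc L) ≤ top) (garbage : Fin 4 → ℕ → ℕ) where

  open Scanning A w n<2^w D top within 3<2^w connected neighbour L L≤n R R<n degrees≡ K 40≤K top≥

  start : Frame (suc n′)
  start = record
    { cursor = 0 ; tail = 0 ; front = 0 ; tick = 0 ; turn = 0 ; limit = 0 ; quot = 0 ; rest = 0
    ; u = word 0 ; r = word 0 ; t = word 0 ; p = ref (adj A zero) ; x = word 0 ; root = word 0
    ; mem = cells (initial prog A w garbage)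
    }

  unscanned : Scan 0 (mem start) [] id id []
  unscanned = record
    { labelled = record
      { forest  = discrete G
      ; circles = λ {q} _ → [] , record
        { path    = refl
        ; members = record { unique = [] ∷ [] ; sound = λ { (here p) → p } ; complete = here } }
      ; status  = λ z → inj₁ record { unlabelled = refl ; own = refl ; loop = refl ; alone = id }
      }
    ; seen  = λ ()
    ; small = z≤n
    }

  boot : SilentSteps 9 (initial prog A w garbage) (at 9 start)
  boot with neighbour zero
  ... | a , as , adj₀ =
    boot-run {garbage = garbage} (truncate-small {w} (<-trans (s≤s (s≤s z≤n)) 3<2^w)) (truncate-small {w} 3<2^w) ▷
    first-step refl refl (cons-step refl (cong ref adj₀) done)

  -- Nine set-up steps and one full period of the clock, four turns of `suc L` ticks, precede the
  -- first edge. They fit into `top`, the bound for every later edge, so there is no preprocessing.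
  enumeration : ∃[ es ] ∃[ f ] (Enumerates prog A w D (initial prog A w garbage) es f ×
                SpanningForest es × sizes f ≡ suc n′ ∷ suc n′ ∷ suc n′ ∷ suc n′ ∷ [])
  enumeration with after {B = K * (suc L * 4)} {B′ = top}
      (≤-trans (+-monoʳ-≤ 9 (≤-reflexive (cong (K *_) (*-comm (suc L) 4)))) top≥) boot
      (loop₁ n′ 0 zero {F = start} {sent = []} {pend = []} {s = 0} {q = 0} {r = 0} 3 refl refl
        (record { front≡ = refl ; tail≡ = refl ; queued = _ }) unscanned (s≤s z≤n) z≤n refl refl refl)
  ... | es , f , timed , forest , sizes≡ = es , f , Timed⇒Enumerates ≤-refl timed , forest , sizes≡

module Main {n′ : ℕ} (w : ℕ) (n<2^w : suc n′ < 2 ^ w) (G : Graph (suc n′)) (connected : Connected G)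
  (A : AdjacencyLists G) (garbage : Fin 4 → ℕ → ℕ) where

  n : ℕ
  n = suc n′

  Result : Set₁
  Result = ∃[ T ] ∃[ es ] ∃[ final ]
    ( IsSpanningTree G T
    × ListsEachEdgeOnce T es
    × Enumerates prog A w ((+ 338 ℚ./ 1) ℚ.* averageDegree A) (initial prog A w garbage) es final
    × Θ[ 338 ] (lazyMemory final) n
    × Θ[ 338 ] (space final) n )

  no-edge : ∀ {v} → adj A v ≡ [] → ∀ {z} → Edge G v z → ∀ {X : Set} → X
  no-edge {v} none {z} e with subst (z ∈_) none (Equivalence.from (correct A v z) e)
  ... | ()

  lone-vertex : adj A zero ≡ [] → Result
  lone-vertex none =
    graph (discrete G) , [] , stopped , spanning (discrete G) one , listed (discrete G) ,
    Run.halts (boot-run {garbage = garbage} refl refl ▷ first-step refl refl (nil-step refl (cong ref none) done)) refl ,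
    prog-memory stopped refl
    where
    0≤0 : ∀ {k} → k ≤ 0 → (+ k ℚ./ 1) ℚ.≤ (+ 0 ℚ./ 1)
    0≤0 z≤n = ℚ.*≤* (ℤ.+≤+ z≤n)
    -- No edge is emitted, so no delay has to be bounded and 0 serves for both bounds.
    open Completion A w n<2^w (+ 0 ℚ./ 1) 0 0≤0
    stopped : State prog n
    stopped = goto 78 (put pʳ (ref (adj A zero))
      (booted (truncate w 1) (truncate w 3) (cells (initial prog A w garbage))))
    alone : ∀ {v} → Star (Edge G) zero v → v ≡ zero
    alone ε       = refl
    alone (e ◅ _) = no-edge none e
    one : ∀ u v → u ≡ v
    one u v = trans (alone (connected zero u)) (sym (alone (connected zero v)))

  pack : ∃[ es ] ∃[ f ] (Enumerates prog A w ((+ 338 ℚ./ 1) ℚ.* averageDegree A) (initial prog A w garbage) es f ×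
           (∃[ C ] (Forest G es C × (∀ u v → C u ≡ C v))) × sizes f ≡ n ∷ n ∷ n ∷ n ∷ []) → Result
  pack (es , f , enumerates , (C , forest , one) , sizes≡) =
    graph forest , es , f , spanning forest one , listed forest , enumerates , prog-memory f sizes≡

  degrees : ℕ
  degrees = sum (map (deg A) (allFin n))

  module _ {a : Fin n} {as : List (Fin n)} (adj₀ : adj A zero ≡ a ∷ as)
    (L R : ℕ) (R<n : R < n) (degrees≡ : degrees ≡ L * n + R) where

    2≤n : 2 ≤ n
    2≤n = two n′ refl
      where
      two : ∀ k → k ≡ n′ → 2 ≤ suc k
      two (suc k) _    = s≤s (s≤s z≤n)
      two zero    refl = contradiction (Equivalence.to (correct A zero a) (subst (a ∈_) (sym adj₀) (here refl)))
        (λ e → irrefl G (subst (Edge G zero) (only a) e))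
        where
        only : (b : Fin 1) → b ≡ zero
        only zero = refl

    neighbour : ∀ v → ∃[ b ] ∃[ bs ] adj A v ≡ b ∷ bs
    neighbour v = go (adj A v) refl (connected v zero)
      where
      go : ∀ l → adj A v ≡ l → Star (Edge G) v zero → ∃[ b ] ∃[ bs ] adj A v ≡ b ∷ bs
      go (b ∷ bs) p _       = b , bs , p
      go []       p ε       = a , as , adj₀
      go []       p (e ◅ _) = no-edge p e

    top : ℕ
    top = 9 + 40 * (4 * suc L)

    L*n≤degrees : L * n ≤ degrees
    L*n≤degrees = subst (L * n ≤_) (sym degrees≡) (m≤m+n (L * n) R)

    length-allFin : length (allFin n) ≡ n
    length-allFin = length-tabulate {n = n} id

    1≤L : 1 ≤ L
    1≤L = n≢0⇒n>0 (λ L≡0 → <⇒≱ R<n (begin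
      n                       ≡⟨ length-allFin ⟨
      length (allFin n)       ≤⟨ length≤sum (deg A) (allFin n) 1≤deg ⟩
      degrees                 ≡⟨ degrees≡ ⟩
      L * n + R               ≡⟨ cong (λ l → l * n + R) L≡0 ⟩
      R                       ∎))
      where
      open ≤-Reasoning
      1≤deg : ∀ v → 1 ≤ deg A v
      1≤deg v with neighbour v
      ... | b , bs , p = subst (λ l → 1 ≤ length l) (sym p) (s≤s z≤n)

    L≤n : L ≤ n
    L≤n = *-cancelʳ-≤ L n n (≤-trans L*n≤degrees
      (subst (λ l → degrees ≤ l * n) length-allFin
        (sum≤length* (deg A) n (allFin n) (λ v → length-Unique≤ (unique A v)))))

    -- The additive 169 is absorbed by `1≤L`, which gives the factor 329; it is rounded up to the
    -- constant that the theorem also uses for memory and space.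
    top≤ : top ≤ 338 * L
    top≤ = begin
      9 + 40 * (4 * suc L)  ≡⟨ expand L ⟩
      169 + 160 * L         ≤⟨ +-monoˡ-≤ (160 * L) (*-monoʳ-≤ 169 1≤L) ⟩
      169 * L + 160 * L     ≡⟨ *-distribʳ-+ L 169 160 ⟨
      329 * L               ≤⟨ *-monoˡ-≤ L (m≤m+n 329 9) ⟩
      338 * L               ∎
      where
      open ≤-Reasoning
      expand : ∀ L → 9 + 40 * (4 * suc L) ≡ 169 + 160 * L
      expand = solve-∀

    within : ∀ {k} → k ≤ top → (+ k ℚ./ 1) ℚ.≤ (+ 338 ℚ./ 1) ℚ.* averageDegree A
    within {k} k≤ = ℚ.*≤* (subst₂ ℤ._≤_ (pos-* k (1 * n)) right (ℤ.+≤+ bound))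
      where
      bound : k * (1 * n) ≤ 338 * degrees
      bound = begin
        k * (1 * n)     ≡⟨ cong (k *_) (*-identityˡ n) ⟩
        k * n           ≤⟨ *-monoˡ-≤ n (≤-trans k≤ top≤) ⟩
        338 * L * n     ≡⟨ *-assoc 338 L n ⟩
        338 * (L * n)   ≤⟨ *-monoʳ-≤ 338 L*n≤degrees ⟩
        338 * degrees   ∎
        where open ≤-Reasoning
      right : + (338 * degrees) ≡ (+ 338 ℤ.* + degrees) ℤ.* + 1
      right = trans (cong +_ (sym (*-identityʳ (338 * degrees))))
        (trans (pos-* (338 * degrees) 1) (cong (ℤ._* + 1) (pos-* 338 degrees)))

    many-vertices : Result
    many-vertices = pack (Launch.enumeration A w n<2^w ((+ 338 ℚ./ 1) ℚ.* averageDegree A) top within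
      (3<2^ w 2≤n n<2^w) connected neighbour L L≤n R R<n degrees≡ 40 ≤-refl ≤-refl garbage)

  result : Result
  result = cases (adj A zero) refl
    where
    cases : ∀ as → adj A zero ≡ as → Result
    cases []       p = lone-vertex p
    cases (a ∷ as) p = many-vertices p (degrees / n) (degrees % n) (m%n<n degrees n)
      (trans (m≡m%n+[m/n]*n degrees n) (+-comm (degrees % n) (degrees / n * n)))

theorem2 : ∃[ P ] ∃[ c ]
    ((n : ℕ) .{{_ : NonZero n}} (w : ℕ) → n < 2 ^ w →
    (G : Graph n) → Connected G → (A : AdjacencyLists G) →
    (garbage : Fin (blocks P) → ℕ → ℕ) →
    ∃[ T ] ∃[ es ] ∃[ final ]
    ( IsSpanningTree G T
    × ListsEachEdgeOnce T es
    × Enumerates P A w ((+ c ℚ./ 1) ℚ.* averageDegree A) (initial P A w garbage) es final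
    × Θ[ c ] (lazyMemory final) n
    × Θ[ c ] (space final) n ))
theorem2 = prog , 338 , λ { (suc n′) w n<2^w G connected A garbage → Main.result w n<2^w G connected A garbage }
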